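{- For every integer $n\ge1$, \[\|C_n\|_{l^2}=\sum_{(\epsilon_1,\ldots,\epsilon_{2n})\in\{0,1\}^{2n}} \bigl(C_n(\epsilon_1,\ldots,\epsilon_{2n})\bigr)^2\] equals the number of domino tilings of the Aztec diamond $AD(n)$, and $\|C_n\|_{l^2}=2^{n(n+1)/2}$.
   Context: The Aztec diamond $AD(n)$ is the union of all unit lattice squares $[i,i+1]\times[j,j+1]$ ($i,j\in\mathbb{Z}$) contained in the region $|x|+|y|\le n+1$; a domino tiling covers it by $1\times2$ or $2\times1$ dominoes without gaps or overlaps. For $m\ge1$, $\mathbb{Z}\langle\{0,1\}^m\rangle$ is the free abelian group with basis the binary sequences of length $m$; maps on basis elements are extended $\mathbb{Z}$-linearly, and a function $\{0,1\}^m\to\mathbb{Z}_{\ge0}$ extends to a homomorphism to $\mathbb{Z}$. (i) $R_m(\epsilon_1,\ldots,\epsilon_m)=(1-\epsilon_1,\ldots,1-\epsilon_m)$. (ii) For $m\ge2$, $1\le i\le m-1$: $E_m^i(\epsilon)=\epsilon+\epsilon'$ if $(\epsilon_i,\epsilon_{i+1})=(0,0)$, with $\epsilon'$ equal to $\epsilon$ with entries $i,i+1$ replaced by $1,1$; $E_m^i(\epsilon)=\epsilon$ otherwise. $E_m=E_m^{m-1}\circ\cdots\circ E_m^1$. (iii) For $m\ge4$, $K_m:\mathbb{Z}\langle\{0,1\}^m\rangle\to\mathbb{Z}\langle\{0,1\}^{m-2}\rangle$: $K_m(\epsilon)=0$ if $(\epsilon_1,\epsilon_2)=(0,1)$ or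 $(\epsilon_{m-1},\epsilon_m)=(1,0)$; otherwise $K_m(\epsilon)=(a,\epsilon_3,\ldots,\epsilon_{m-2},b)$ with $a=0$ if $(\epsilon_1,\epsilon_2)=(1,0)$, $a=1$ if $(\epsilon_1,\epsilon_2)\in\{(0,0),(1,1)\}$, $b=0$ if $(\epsilon_{m-1},\epsilon_m)=(0,1)$, $b=1$ if $(\epsilon_{m-1},\epsilon_m)\in\{(0,0),(1,1)\}$. (iv) $C_1(0,0)=C_1(1,1)=1$, $C_1(0,1)=C_1(1,0)=0$; for $n\ge2$, $C_n:\{0,1\}^{2n}\to\mathbb{Z}_{\ge0}$ is $C_n=C_{n-1}\circ R_{2n-2}\circ E_{2n-2}\circ K_{2n}$. -}

module Defs where

open import Data.Bool using (Bool; true; false; not; if_then_else_; _∧_)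
open import Data.Nat using (ℕ; zero; suc; _+_; _*_; _∸_; _≤ᵇ_; _≡ᵇ_)
open import Data.Integer as ℤ using (ℤ; +_; ∣_∣)
open import Data.Product using (_×_; _,_; proj₁; proj₂)
open import Data.List using (List; []; _∷_; map; concatMap; length; filter; foldl; upTo; _++_)
open import Data.Nat.ListAction using (sum)
open import Data.Bool.ListAction using () renaming (all to allL)
open import Data.Vec using (Vec; []; _∷_; _∷ʳ_)
import Data.Vec as Vec
open import Relation.Nullary.Decidable using (⌊_⌋)
open import Data.Bool.Properties using () renaming (_≟_ to _≟B_)

-- Binary sequences {0,1}^m are 'Vec Bool m' (false = 0, true = 1).
-- An element of Z<{0,1}^m> with nonnegative coefficients (all elements
-- that arise below) is represented by a list of basis elements, read as
-- their formal sum.  Maps on basis elements are extended linearly by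
-- concatMap (resp. sum ∘ map for Z-valued functions).

Seq : ℕ → Set
Seq m = Vec Bool m

Lin : ℕ → Set
Lin m = List (Seq m)

R : ∀ {m} → Seq m → Lin m
R v = Vec.map not v ∷ []

-- E_m^{k+1}  (0-based position k, acting on entries k+1, k+2)
Estep : ∀ {m} → ℕ → Seq m → Lin m
Estep zero (false ∷ false ∷ xs) = (false ∷ false ∷ xs) ∷ (true ∷ true ∷ xs) ∷ []
Estep zero v = v ∷ []
Estep (suc k) [] = [] ∷ []
Estep (suc k) (x ∷ xs) = map (x ∷_) (Estep k xs)

Elin : ∀ {m} → Lin m → Lin m
Elin {m} xs = foldl (λ acc k → concatMap (Estep k) acc) xs (upTo (m ∸ 1))

lastTwo : ∀ {k} → Vec Bool (suc (suc k)) → Vec Bool k × Bool × Bool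
lastTwo {zero} (a ∷ b ∷ []) = [] , a , b
lastTwo {suc k} (x ∷ xs) with lastTwo xs
... | mid , a , b = (x ∷ mid) , a , b

K : ∀ {k} → Seq (suc (suc (suc (suc k)))) → Lin (suc (suc k))
K (e1 ∷ e2 ∷ rest) with lastTwo rest
K (false ∷ true ∷ rest) | _ = []
K (e1 ∷ e2 ∷ rest) | mid , true , false = []
K (e1 ∷ e2 ∷ rest) | mid , f1 , f2 =
  ((if e1 ∧ not e2 then false else true) ∷ (mid ∷ʳ (if not f1 ∧ f2 then false else true))) ∷ []

dbl : ℕ → ℕ
dbl zero = zero
dbl (suc n) = suc (suc (dbl n))

-- C_n : {0,1}^{2n} → Z≥0  (the value at n = 0 is an unused junk value)
C : (n : ℕ) → Seq (dbl n) → ℕ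
C zero _ = 0
C (suc zero) (a ∷ b ∷ []) = if ⌊ a ≟B b ⌋ then 1 else 0
C (suc (suc k)) v =
  sum (map (C (suc k)) (concatMap R (Elin (K v))))

allSeq : (m : ℕ) → List (Seq m)
allSeq zero = [] ∷ []
allSeq (suc m) = map (false ∷_) (allSeq m) ++ map (true ∷_) (allSeq m)

normC : ℕ → ℕ
normC n = sum (map (λ v → C n v * C n v) (allSeq (dbl n)))

Cell : Set
Cell = ℤ × ℤ

inDiamond : ℕ → ℤ → ℤ → Bool
inDiamond n x y = (∣ x ∣ + ∣ y ∣) ≤ᵇ suc n

-- the unit square [i,i+1]×[j,j+1] is contained in |x|+|y| ≤ n+1
-- (the region is convex, so this holds iff all four corners lie in it)
inAD : ℕ → Cell → Bool
inAD n (i , j) =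
  inDiamond n i j ∧ inDiamond n (i ℤ.+ + 1) j ∧
  inDiamond n i (j ℤ.+ + 1) ∧ inDiamond n (i ℤ.+ + 1) (j ℤ.+ + 1)

-- integers -(n+1), …, n  (any cell of AD(n) has coordinates in this range)
range : ℕ → List ℤ
range n = map (λ t → + t ℤ.- + suc n) (upTo (dbl (suc n)))

cells : ℕ → List Cell
cells n = filter (λ c → inAD n c ≟B true)
                 (concatMap (λ i → map (λ j → (i , j)) (range n)) (range n))

Domino : Set
Domino = Cell × Cell

dominoes : ℕ → List Domino
dominoes n =
  concatMap (λ { (i , j) → if inAD n (i ℤ.+ + 1 , j)
                             then ((i , j) , (i ℤ.+ + 1 , j)) ∷ [] else [] }) (cells n)
  ++
  concatMap (λ { (i , j) → if inAD n (i , j ℤ.+ + 1)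
                             then ((i , j) , (i , j ℤ.+ + 1)) ∷ [] else [] }) (cells n)

eqCell : Cell → Cell → Bool
eqCell (a , b) (c , d) = ⌊ a ℤ.≟ c ⌋ ∧ ⌊ b ℤ.≟ d ⌋

coverCount : Cell → List Domino → List Bool → ℕ
coverCount c (d ∷ ds) (true ∷ s) =
  (if eqCell c (proj₁ d) then 1 else 0) + (if eqCell c (proj₂ d) then 1 else 0)
  + coverCount c ds s
coverCount c (d ∷ ds) (false ∷ s) = coverCount c ds s
coverCount c _ _ = 0

allSubsets : ℕ → List (List Bool)
allSubsets zero = [] ∷ []
allSubsets (suc k) = map (false ∷_) (allSubsets k) ++ map (true ∷_) (allSubsets k)

isTiling : (n : ℕ) → List Bool → Bool
isTiling n s = allL (λ c → coverCount c (dominoes n) s ≡ᵇ 1) (cells n)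

numTilings : ℕ → ℕ
numTilings n = length (filter (λ s → isTiling n s ≟B true) (allSubsets (length (dominoes n))))

{-# OPTIONS --safe #-}
module Submission where

-- Cutting AD(n) along its middle line, with ε recording which dominoes cross the cut, leaves
-- two mirror-image halves, each with C_n(ε) tilings: K settles the two end cells of the longest
-- row, E places the dominoes inside that row, and R passes to the next row, whose already
-- covered cells are those above the cells still free.  Hence Σ C_n(ε)² counts the tilings.
--
-- For the product formula write E = U_even U_odd, with U = (00 ↦ 00 + 11) acting on disjoint
-- pairs, and let L = (11 ↦ 11 + 00) be its transpose.  On functions of one pair, with t = 2^(k/2)
-- for k ones in the pair, L U = ½ t (U L) t: this is [1 1; 1 2] = ½ diag(1,2) [2 1; 1 1] diag(1,2)
-- on (00, 11) and trivial on 01 and 10 (urban renewal).  Moving all these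
-- factors past each other turns the diamond of order n + 1 into the diamond of order n, with a
-- total factor of 2ⁿ⁺¹.

open import Defs
open import Algebra.Bundles using (AbelianGroup)
open import Data.Bool using (Bool; true; false; not; if_then_else_; _∧_)
open import Data.Bool.ListAction using () renaming (all to allL)
open import Data.Bool.Properties using (not-involutive; T-≡; T-∧) renaming (_≟_ to _≟B_)
open import Data.Integer as ℤ using (ℤ; -[1+_]; _⊖_; ∣_∣)
import Data.Integer.Properties as ℤ
open import Algebra.Properties.Group (AbelianGroup.group ℤ.+-0-abelianGroup) using (∙-cancelʳ)
open import Data.List
  using (List; []; _∷_; map; _++_; foldl; foldr; concatMap; upTo; applyUpTo; filter; length; cartesianProduct)
open import Data.List.Membership.Propositional using (_∈_)
open import Data.List.Membership.Propositional.Properties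
  using (∈-++⁺ˡ; ∈-++⁺ʳ; ∈-++⁻; ∈-map⁺; ∈-map⁻; ∈-filter⁺; ∈-filter⁻; ∈-upTo⁺; ∈-cartesianProduct⁺)
open import Data.List.Membership.Propositional.Properties.WithK using (unique∧set⇒bag)
open import Data.List.Properties
  using (map-++; map-∘; map-id; map-cong; map-upTo; length-++; filter-++; ++-assoc; ++-identityʳ)
open import Data.List.Relation.Binary.BagAndSetEquality using (∼bag⇒↭)
open import Data.List.Relation.Binary.Permutation.Propositional as ↭ using (_↭_; prep; swap)
open import Data.List.Relation.Unary.All using (All; []; _∷_)
import Data.List.Relation.Unary.All as All
import Data.List.Relation.Unary.All.Properties as All
open import Data.List.Relation.Unary.Any using (here; there)
open import Data.List.Relation.Unary.Unique.Propositional using (Unique; []; _∷_)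
import Data.List.Relation.Unary.Unique.Propositional.Properties as Unique
open import Data.Nat
  using (ℕ; zero; suc; _+_; _*_; _∸_; _^_; _≡ᵇ_; _≤ᵇ_; _≤_; _<_; z≤n; s≤s; z<s; s<s; s≤s⁻¹; s<s⁻¹)
open import Data.Nat.Divisibility using (n∣m*n)
open import Data.Nat.DivMod using (_/_; m*n/n≡m; +-distrib-/-∣ʳ)
open import Data.Nat.ListAction using (sum)
open import Data.Nat.ListAction.Properties using (sum-++)
open import Data.Nat.Properties
open import Data.Nat.Tactic.RingSolver using (solve-∀)
open import Data.Product using (_×_; _,_; proj₁; proj₂; ∃-syntax)
open import Data.Sum using (inj₁; inj₂)
open import Data.Unit using (⊤; tt)
open import Data.Vec using (Vec; []; _∷_; _∷ʳ_)
import Data.Vec as Vec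
open import Function using (_∘_; id; mk⇔; Equivalence)
open import Relation.Binary.PropositionalEquality
  using (_≡_; _≢_; refl; sym; trans; cong; cong₂; subst; subst₂; _≗_; module ≡-Reasoning)
open import Relation.Nullary using (¬_; yes; no; contradiction)

-- The weights from urban renewal do not accumulate. Passing `cap` costs a factor 2, since exactly
-- one of the two covered end cells is weighted. What remains of the weight meets, in the
-- complemented sequence, the weight released by the next exchange, and the product of the two is
-- constant. Each half of the diamond of order n + 1 thus yields one 2 for each of its n + 1 rows,
-- and the exchange at the cut takes 2^(n+1) back. The displaced factors recombine into full rows,
-- one fewer than before.
--
-- On the tiling side, `numTilings` filters the subsets of one list whose order has nothing to do
-- with rows. The count is therefore shown not to depend on the order of cells and dominoes. It is
-- then evaluated on lists arranged so that, once the dominoes listed with a cell are decided,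
-- nothing later covers that cell: the condition there can be tested at once, and a row becomes an
-- operator.

private variable
  m k : ℕ

-- Linear operators on functions of binary sequences.

Fn : ℕ → Set
Fn m = Seq m → ℕ

infixl 6 _⊕_
infixl 7 _⊙_ _·_
_⊕_ _⊙_ : Fn m → Fn m → Fn m
(f ⊕ g) v = f v + g v
(f ⊙ g) v = f v * g v

_·_ : ℕ → Fn m → Fn m
(c · f) v = c * f v

-- Operators are compared pointwise, so compatibility with pointwise equality is a field; since the
-- scalars are natural numbers, homogeneity follows from additivity.
record Linear (T : Fn m → Fn k) : Set where
  field
    resp : ∀ {f g} → f ≗ g → T f ≗ T g
    add  : ∀ f g → T (f ⊕ g) ≗ T f ⊕ T g

  null : T (λ _ → 0) ≗ (λ _ → 0)
  null v = m+n≡m⇒n≡0 (T (λ _ → 0) v) (add (λ _ → 0) (λ _ → 0) v)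
    where
    m+n≡m⇒n≡0 : ∀ a → a ≡ a + a → a ≡ 0
    m+n≡m⇒n≡0 a e = sym (+-cancelˡ-≡ a 0 a (trans (+-identityʳ a) e))

  scale : ∀ c f → T (c · f) ≗ c · T f
  scale zero f = null
  scale (suc c) f v = trans (add f (c · f) v) (cong (T f v +_) (scale c f v))

open Linear

id-linear : Linear {m} id
id-linear .resp e = e
id-linear .add f g v = refl

skip : (Fn m → Fn k) → Fn (suc m) → Fn (suc k)
skip T f (x ∷ v) = T (f ∘ (x ∷_)) v

skip-linear : {T : Fn m → Fn k} → Linear T → Linear (skip T)
skip-linear l .resp e (x ∷ v) = resp l (e ∘ (x ∷_)) v
skip-linear l .add f g (x ∷ v) = add l (f ∘ (x ∷_)) (g ∘ (x ∷_)) v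

skip-cong : {T U : Fn m → Fn k} → (∀ f → T f ≗ U f) → ∀ f → skip T f ≗ skip U f
skip-cong e f (x ∷ v) = e (f ∘ (x ∷_)) v

skip-∘ : ∀ {l} (T : Fn k → Fn l) (U : Fn m → Fn k) (f : Fn (suc m)) → skip (T ∘ U) f ≗ skip T (skip U f)
skip-∘ T U f (x ∷ v) = refl

-- The moves U and L, and the rows built from them.

-- hop false and hop true are the transposed moves U and L of the header; maps on sequences are
-- represented by the operators they induce on functions, so compositions appear in reverse order.
hop : Bool → Fn (suc (suc m)) → Fn (suc (suc m))
hop false f (false ∷ false ∷ v) = f (false ∷ false ∷ v) + f (true ∷ true ∷ v)
hop true  f (true ∷ true ∷ v)   = f (true ∷ true ∷ v) + f (false ∷ false ∷ v)
hop _     f v                   = f v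

∘-linear : ∀ {m k l} {T : Fn k → Fn l} {U : Fn m → Fn k} → Linear T → Linear U → Linear (T ∘ U)
∘-linear t u .resp e = resp t (resp u e)
∘-linear t u .add f g v = trans (resp t (add u f g) v) (add t _ _ v)

+-swap : ∀ a b c d → (a + b) + (c + d) ≡ (a + c) + (b + d)
+-swap = solve-∀

hop-linear : ∀ b → Linear (hop {m} b)
hop-linear false .resp e (false ∷ false ∷ v) = cong₂ _+_ (e _) (e _)
hop-linear false .resp e (false ∷ true ∷ v) = e _
hop-linear false .resp e (true ∷ _ ∷ v) = e _
hop-linear true .resp e (true ∷ true ∷ v) = cong₂ _+_ (e _) (e _)
hop-linear true .resp e (true ∷ false ∷ v) = e _
hop-linear true .resp e (false ∷ _ ∷ v) = e _
hop-linear false .add f g (false ∷ false ∷ v) = +-swap (f _) (g _) (f _) (g _)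
hop-linear false .add f g (false ∷ true ∷ v) = refl
hop-linear false .add f g (true ∷ _ ∷ v) = refl
hop-linear true .add f g (true ∷ true ∷ v) = +-swap (f _) (g _) (f _) (g _)
hop-linear true .add f g (true ∷ false ∷ v) = refl
hop-linear true .add f g (false ∷ _ ∷ v) = refl

evens odds row : Bool → Fn m → Fn m
evens {zero} b f = f
evens {suc zero} b f = f
evens {suc (suc m)} b f = hop b (skip (skip (evens b)) f)

odds {zero} b f = f
odds {suc m} b f = skip (evens b) f

row {zero} b f = f
row {suc zero} b f = f
row {suc (suc m)} b f = hop b (skip (row b) f)

evens-linear : ∀ b → Linear (evens {m} b)
evens-linear {zero} b = id-linear
evens-linear {suc zero} b = id-linear
evens-linear {suc (suc m)} b = ∘-linear (hop-linear b) (skip-linear (skip-linear (evens-linear b)))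

row-linear : ∀ b → Linear (row {m} b)
row-linear {zero} b = id-linear
row-linear {suc zero} b = id-linear
row-linear {suc (suc m)} b = ∘-linear (hop-linear b) (skip-linear (row-linear b))

hop-skip² : ∀ b {T : Fn m → Fn m} → Linear T → ∀ f →
  hop b (skip (skip T) f) ≗ skip (skip T) (hop b f)
hop-skip² false t f (false ∷ false ∷ v) = sym (add t _ _ v)
hop-skip² false t f (false ∷ true ∷ v) = refl
hop-skip² false t f (true ∷ _ ∷ v) = refl
hop-skip² true t f (true ∷ true ∷ v) = sym (add t _ _ v)
hop-skip² true t f (true ∷ false ∷ v) = refl
hop-skip² true t f (false ∷ _ ∷ v) = refl

+-rotate : ∀ a b c → a + b + c ≡ a + c + b
+-rotate = solve-∀

-- Two overlapping moves of the same kind exclude each other: after one of them the shared entry has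
-- changed, so the other no longer applies. From 000, either order gives 000 + 110 + 011.
hop-skip-hop : ∀ b (f : Fn (suc (suc (suc m)))) → hop b (skip (hop b) f) ≗ skip (hop b) (hop b f)
hop-skip-hop false f (false ∷ false ∷ false ∷ v) = +-rotate (f _) (f _) (f _)
hop-skip-hop false f (false ∷ false ∷ true ∷ v) = refl
hop-skip-hop false f (false ∷ true ∷ _ ∷ v) = refl
hop-skip-hop false f (true ∷ false ∷ false ∷ v) = refl
hop-skip-hop false f (true ∷ false ∷ true ∷ v) = refl
hop-skip-hop false f (true ∷ true ∷ _ ∷ v) = refl
hop-skip-hop true f (true ∷ true ∷ true ∷ v) = +-rotate (f _) (f _) (f _)
hop-skip-hop true f (true ∷ true ∷ false ∷ v) = refl
hop-skip-hop true f (true ∷ false ∷ _ ∷ v) = refl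
hop-skip-hop true f (false ∷ true ∷ true ∷ v) = refl
hop-skip-hop true f (false ∷ true ∷ false ∷ v) = refl
hop-skip-hop true f (false ∷ false ∷ _ ∷ v) = refl

-- Only the first move of the shifted layer overlaps the given one; all later ones act on disjoint
-- entries.
hop-skip-evens : ∀ b (f : Fn (suc (suc m))) → hop b (skip (evens b) f) ≗ skip (evens b) (hop b f)
hop-skip-evens {zero} b f v =
  trans (resp (hop-linear b) (λ { (_ ∷ _) → refl }) v) (lemma v)
  where
  lemma : hop b f ≗ skip (evens b) (hop b f)
  lemma (_ ∷ _) = refl
hop-skip-evens {suc m} b f v@(x ∷ w) = begin
  hop b (skip (evens b) f) v
    ≡⟨ resp (hop-linear b) (λ { (_ ∷ _) → refl }) v ⟩
  hop b (skip (hop b) (skip (skip (skip (evens b))) f)) v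
    ≡⟨ hop-skip-hop b (skip (skip (skip (evens b))) f) v ⟩
  skip (hop b) (hop b (skip (skip (skip (evens b))) f)) v
    ≡⟨ resp (skip-linear (hop-linear b)) (hop-skip² b (skip-linear (evens-linear b)) f) v ⟩
  skip (hop b) (skip (skip (skip (evens b))) (hop b f)) v ∎
  where open ≡-Reasoning

-- Prepending an entry exchanges the parities, so each factorization uses the other one for the
-- shorter row. Only the second has to move a hop past an overlapping layer.
row-evens-odds : ∀ b (f : Fn m) → row b f ≗ evens b (odds b f)
row-odds-evens : ∀ b (f : Fn m) → row b f ≗ odds b (evens b f)

row-evens-odds {zero} b f v = refl
row-evens-odds {suc zero} b f (x ∷ []) = refl
row-evens-odds {suc (suc m)} b f v = resp (hop-linear b)
  (λ w → trans (skip-cong (row-odds-evens b) f w) (skip-∘ (skip (evens b)) (evens b) f w)) v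

row-odds-evens {zero} b f v = refl
row-odds-evens {suc zero} b f (x ∷ []) = refl
row-odds-evens {suc (suc m)} b f v = trans
  (resp (hop-linear b)
    (λ w → trans (skip-cong (row-evens-odds b) f w) (skip-∘ (evens b) (skip (evens b)) f w)) v)
  (hop-skip-evens b (skip (skip (evens b)) f) v)

-- End cells, complements, and how the layers pass them.

capʳ : Fn m → Fn (suc m)
capʳ {zero} f (x ∷ []) = if x then f [] else 0
capʳ {suc m} f (x ∷ v) = capʳ (f ∘ (x ∷_)) v

-- Both end cells of a row have to be covered within the row, as no cell lies beyond them.
cap : Fn m → Fn (suc (suc m))
cap f (true ∷ v) = capʳ f v
cap f (false ∷ v) = 0

capʳ-linear : Linear (capʳ {m})
capʳ-linear {zero} .resp e (false ∷ []) = refl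
capʳ-linear {zero} .resp e (true ∷ []) = e []
capʳ-linear {zero} .add f g (false ∷ []) = refl
capʳ-linear {zero} .add f g (true ∷ []) = refl
capʳ-linear {suc m} .resp e (x ∷ v) = resp capʳ-linear (e ∘ (x ∷_)) v
capʳ-linear {suc m} .add f g (x ∷ v) = add capʳ-linear (f ∘ (x ∷_)) (g ∘ (x ∷_)) v

cap-linear : Linear (cap {m})
cap-linear .resp e (true ∷ v) = resp capʳ-linear e v
cap-linear .resp e (false ∷ v) = refl
cap-linear .add f g (true ∷ v) = add capʳ-linear f g v
cap-linear .add f g (false ∷ v) = refl

evens-capʳ-step : ∀ b → (∀ (f : Fn m) → evens b (capʳ f) ≗ capʳ (evens b f)) →
  ∀ (f : Fn (suc (suc m))) → evens b (capʳ f) ≗ capʳ (evens b f)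
evens-capʳ-step false ih f (false ∷ false ∷ v) =
  trans (cong₂ _+_ (ih _ v) (ih _ v)) (sym (add capʳ-linear _ _ v))
evens-capʳ-step false ih f (false ∷ true ∷ v) = ih _ v
evens-capʳ-step false ih f (true ∷ false ∷ v) = ih _ v
evens-capʳ-step false ih f (true ∷ true ∷ v) = ih _ v
evens-capʳ-step true ih f (true ∷ true ∷ v) =
  trans (cong₂ _+_ (ih _ v) (ih _ v)) (sym (add capʳ-linear _ _ v))
evens-capʳ-step true ih f (true ∷ false ∷ v) = ih _ v
evens-capʳ-step true ih f (false ∷ true ∷ v) = ih _ v
evens-capʳ-step true ih f (false ∷ false ∷ v) = ih _ v

evens-capʳ-even : ∀ n b (f : Fn (dbl n)) → evens b (capʳ f) ≗ capʳ (evens b f)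
evens-capʳ-even zero b f v = refl
evens-capʳ-even (suc n) b f = evens-capʳ-step b (evens-capʳ-even n b) f

-- For L the last entry may even belong to a pair: the extra term is the value at 00, where `capʳ`
-- vanishes. For U the extra term, at 11, would survive.
evens-capʳ-true : (f : Fn m) → evens true (capʳ f) ≗ capʳ (evens true f)
evens-capʳ-true {zero} f v = refl
evens-capʳ-true {suc zero} f (true ∷ true ∷ []) = +-identityʳ _
evens-capʳ-true {suc zero} f (true ∷ false ∷ []) = refl
evens-capʳ-true {suc zero} f (false ∷ true ∷ []) = refl
evens-capʳ-true {suc zero} f (false ∷ false ∷ []) = refl
evens-capʳ-true {suc (suc m)} f = evens-capʳ-step true evens-capʳ-true f

-- In a row of even length the odd pairs avoid both end entries, and deleting the first entry turns
-- them into even pairs.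
odds-cap : ∀ n b (f : Fn (dbl n)) → odds b (cap f) ≗ cap (evens b f)
odds-cap n b f (true ∷ v) = evens-capʳ-even n b f v
odds-cap n b f (false ∷ v) = null (evens-linear b) v

-- The pairs at the ends act trivially, since the extra term of L has a 0 at an end and `cap` kills
-- it; the inner pairs change parity.
evens-cap : (f : Fn m) → evens true (cap f) ≗ cap (odds true f)
evens-cap {zero} f (true ∷ true ∷ []) = +-identityʳ _
evens-cap {zero} f (true ∷ false ∷ []) = refl
evens-cap {zero} f (false ∷ _ ∷ []) = refl
evens-cap {suc m} f (true ∷ true ∷ v) =
  trans (cong₂ _+_ (evens-capʳ-true _ v) (null (evens-linear true) v)) (+-identityʳ _)
evens-cap {suc m} f (true ∷ false ∷ v) = evens-capʳ-true _ v
evens-cap {suc m} f (false ∷ _ ∷ v) = null (evens-linear true) v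

flip : Fn m → Fn m
flip f = f ∘ Vec.map not

evens-flip : ∀ b (f : Fn m) → evens b (flip f) ≗ flip (evens (not b) f)
evens-flip {zero} b f v = refl
evens-flip {suc zero} b f v = refl
evens-flip {suc (suc m)} false f (false ∷ false ∷ v) = cong₂ _+_ (evens-flip _ _ v) (evens-flip _ _ v)
evens-flip {suc (suc m)} false f (false ∷ true ∷ v) = evens-flip _ _ v
evens-flip {suc (suc m)} false f (true ∷ false ∷ v) = evens-flip _ _ v
evens-flip {suc (suc m)} false f (true ∷ true ∷ v) = evens-flip _ _ v
evens-flip {suc (suc m)} true f (true ∷ true ∷ v) = cong₂ _+_ (evens-flip _ _ v) (evens-flip _ _ v)
evens-flip {suc (suc m)} true f (false ∷ true ∷ v) = evens-flip _ _ v
evens-flip {suc (suc m)} true f (true ∷ false ∷ v) = evens-flip _ _ v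
evens-flip {suc (suc m)} true f (false ∷ false ∷ v) = evens-flip _ _ v

odds-flip : ∀ b (f : Fn m) → odds b (flip f) ≗ flip (odds (not b) f)
odds-flip {zero} b f v = refl
odds-flip {suc m} b f (x ∷ v) = evens-flip b (f ∘ (not x ∷_)) v

-- Weights and urban renewal.

wt₁ : Bool → Bool → ℕ
wt₁ p x = if p ∧ x then 2 else 1

-- 2 to the number of ones in the odd places (first, third, ...) if p is `true`, in the even places
-- otherwise.
wt : Bool → Fn m
wt p [] = 1
wt p (x ∷ v) = wt₁ p x * wt (not p) v

-- p selects which member of each pair carries the weight on the inner side: the symmetric
-- weight t is replaced by integral ones, since U and L preserve the difference of the two entries.
spider : ∀ n p (f : Fn (dbl n)) →
  2 ^ n · evens true (evens false f) ≗ wt (not p) ⊙ evens false (evens true (wt p ⊙ f))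
spider zero p f [] = arith (f [])
  where
  arith : ∀ a → 1 * a ≡ 1 * (1 * a)
  arith = solve-∀
spider (suc n) p f (x ∷ y ∷ v) = go p x y
  where
  open ≡-Reasoning
  G H : Bool → Bool → Bool → ℕ
  G _ x y = evens true (evens false (λ w → f (x ∷ y ∷ w))) v
  H p x y = evens false (evens true (wt p ⊙ (λ w → f (x ∷ y ∷ w)))) v
  T-linear = ∘-linear (evens-linear {dbl n} false) (evens-linear true)
  ih : ∀ p x y → 2 ^ n * G p x y ≡ wt (not p) v * H p x y
  ih p x y = spider n p (λ w → f (x ∷ y ∷ w)) v
  F : Bool → Bool → Bool → Fn (dbl n)
  F p x y w = wt p (x ∷ y ∷ w) * f (x ∷ y ∷ w)
  c : Bool → Bool → Bool → ℕ
  c p x y = wt₁ p x * wt₁ (not p) y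
  pull : ∀ p x y → evens false (evens true (F p x y)) v ≡ c p x y * H p x y
  pull p x y = trans (resp T-linear (λ w → trans
      (cong (λ q → wt₁ p x * (wt₁ (not p) y * wt q w) * f (x ∷ y ∷ w)) (not-involutive p))
      (regroup (wt₁ p x) (wt₁ (not p) y) (wt p w) _)) v)
    (scale T-linear (c p x y) _ v)
    where
    regroup : ∀ a b c d → a * (b * c) * d ≡ a * b * (c * d)
    regroup = solve-∀
  wt-pull : ∀ p x y → wt p (x ∷ y ∷ v) ≡ c p x y * wt p v
  wt-pull p x y = trans (cong (λ q → wt₁ p x * (wt₁ (not p) y * wt q v)) (not-involutive p))
    (sym (*-assoc (wt₁ p x) _ _))
  one : ∀ a w g h → 2 ^ n * g ≡ w * h → ∀ b → b * a ≡ 2 → 2 ^ suc n * g ≡ b * w * (a * h)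
  one a w g h e b ab = begin
    2 * 2 ^ n * g       ≡⟨ *-assoc 2 (2 ^ n) g ⟩
    2 * (2 ^ n * g)     ≡⟨ cong₂ _*_ (sym ab) e ⟩
    b * a * (w * h)     ≡⟨ shuffle b a w h ⟩
    b * w * (a * h)     ∎
    where
    shuffle : ∀ b a w h → b * a * (w * h) ≡ b * w * (a * h)
    shuffle = solve-∀
  -- On 01 and 10 nothing moves. The single 1 is weighted by exactly one of `wt p` and `wt (not p)`,
  -- which supplies the 2 of this pair.
  c₀₁ : ∀ p → c (not p) false true * c p false true ≡ 2
  c₀₁ false = refl
  c₀₁ true = refl
  c₁₀ : ∀ p → c (not p) true false * c p true false ≡ 2
  c₁₀ false = refl
  c₁₀ true = refl
  c₀₀ : ∀ p → c p false false ≡ 1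
  c₀₀ false = refl
  c₀₀ true = refl
  c₁₁ : ∀ p → c p true true ≡ 2
  c₁₁ false = refl
  c₁₁ true = refl
  go : ∀ p x y → 2 ^ suc n * evens true (evens false f) (x ∷ y ∷ v)
       ≡ wt (not p) (x ∷ y ∷ v) * evens false (evens true (wt p ⊙ f)) (x ∷ y ∷ v)
  go p false true = trans (one (c p false true) (wt (not p) v) _ (H p false true) (ih p false true) (c (not p) false true) (c₀₁ p))
    (sym (cong₂ _*_ (wt-pull (not p) false true) (pull p false true)))
  go p true false = trans (one (c p true false) (wt (not p) v) _ (H p true false) (ih p true false) (c (not p) true false) (c₁₀ p))
    (sym (cong₂ _*_ (wt-pull (not p) true false) (pull p true false)))
  go p false false = begin
    2 ^ suc n * evens true (evens false f) (false ∷ false ∷ v)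
      ≡⟨ cong (2 ^ suc n *_) (add (evens-linear true) _ _ v) ⟩
    2 ^ suc n * (G p false false + G p true true)
      ≡⟨ distr (2 ^ n) _ _ ⟩
    2 * (2 ^ n * G p false false) + 2 * (2 ^ n * G p true true)
      ≡⟨ cong₂ (λ a b → 2 * a + 2 * b) (ih p false false) (ih p true true) ⟩
    2 * (W * H p false false) + 2 * (W * H p true true)
      -- The row of 00 in 2 [1 1; 1 2] = diag(1,2) [2 1; 1 1] diag(1,2): the outer weight is 1, and
      -- the value at 11 enters with inner weight 2.
      ≡⟨ arith W (H p false false) (H p true true) ⟩
    1 * W * (1 * H p false false + (2 * H p true true + 1 * H p false false))
      ≡⟨ cong₂ (λ a b → a * W * (b * H p false false + (2 * H p true true + b * H p false false))) (sym (c₀₀ (not p))) (sym (c₀₀ p)) ⟩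
    c (not p) false false * W * (c p false false * H p false false + (2 * H p true true + c p false false * H p false false))
      ≡⟨ cong (λ a → c (not p) false false * W * (c p false false * H p false false + (a * H p true true + c p false false * H p false false))) (sym (c₁₁ p)) ⟩
    c (not p) false false * W * (c p false false * H p false false + (c p true true * H p true true + c p false false * H p false false))
      ≡⟨ sym (cong₂ _*_ (wt-pull (not p) false false) (cong₂ _+_ (pull p false false)
           (trans (add (evens-linear false) _ _ v) (cong₂ _+_ (pull p true true) (pull p false false))))) ⟩
    wt (not p) (false ∷ false ∷ v) * evens false (evens true (wt p ⊙ f)) (false ∷ false ∷ v) ∎
    where
    W = wt (not p) v
    distr : ∀ k a b → 2 * k * (a + b) ≡ 2 * (k * a) + 2 * (k * b)
    distr = solve-∀
    arith : ∀ w a b → 2 * (w * a) + 2 * (w * b) ≡ 1 * w * (1 * a + (2 * b + 1 * a))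
    arith = solve-∀
  go p true true = begin
    2 ^ suc n * evens true (evens false f) (true ∷ true ∷ v)
      ≡⟨ cong (λ s → 2 ^ suc n * (G p true true + s)) (add (evens-linear true) _ _ v) ⟩
    2 ^ suc n * (G p true true + (G p false false + G p true true))
      ≡⟨ distr (2 ^ n) _ _ ⟩
    2 * (2 ^ n * G p true true + (2 ^ n * G p false false + 2 ^ n * G p true true))
      ≡⟨ cong₂ (λ a b → 2 * (b + (a + b))) (ih p false false) (ih p true true) ⟩
    2 * (W * H p true true + (W * H p false false + W * H p true true))
      -- The row of 11 in the same identity, with outer weight 2.
      ≡⟨ arith W (H p false false) (H p true true) ⟩
    2 * W * (2 * H p true true + 1 * H p false false)
      ≡⟨ cong₂ (λ a b → a * W * (b * H p true true + 1 * H p false false)) (sym (c₁₁ (not p))) (sym (c₁₁ p)) ⟩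
    c (not p) true true * W * (c p true true * H p true true + 1 * H p false false)
      ≡⟨ cong (λ a → c (not p) true true * W * (c p true true * H p true true + a * H p false false)) (sym (c₀₀ p)) ⟩
    c (not p) true true * W * (c p true true * H p true true + c p false false * H p false false)
      ≡⟨ sym (cong₂ _*_ (wt-pull (not p) true true)
           (trans (add (evens-linear false) _ _ v) (cong₂ _+_ (pull p true true) (pull p false false)))) ⟩
    wt (not p) (true ∷ true ∷ v) * evens false (evens true (wt p ⊙ f)) (true ∷ true ∷ v) ∎
    where
    W = wt (not p) v
    distr : ∀ k a b → 2 * k * (b + (a + b)) ≡ 2 * (k * b + (k * a + k * b))
    distr = solve-∀
    arith : ∀ w a b → 2 * (w * b + (w * a + w * b)) ≡ 2 * w * (2 * b + 1 * a)
    arith = solve-∀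

-- Where `cap f` can be nonzero, both ends are 1. The length is even, so the ends lie in places of
-- opposite parity and exactly one of them contributes a 2; deleting the first entry shifts the
-- parity of the others.
wt-cap : ∀ n p (f : Fn (dbl n)) → wt p ⊙ cap f ≗ 2 · cap (wt (not p) ⊙ f)
wt-cap n p f (false ∷ v) = *-zeroʳ (wt p (false ∷ v))
wt-cap n p f (true ∷ v) = go n p f v
  where
  open ≡-Reasoning
  go : ∀ n p (f : Fn (dbl n)) v →
    wt p (true ∷ v) * capʳ f v ≡ 2 * capʳ (wt (not p) ⊙ f) v
  go zero false f (false ∷ []) = refl
  go zero true f (false ∷ []) = refl
  go zero false f (true ∷ []) = cong (2 *_) (sym (*-identityˡ (f [])))
  go zero true f (true ∷ []) = cong (2 *_) (sym (*-identityˡ (f [])))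
  go (suc n) p f (x ∷ y ∷ v) = begin
    wt p (true ∷ x ∷ y ∷ v) * capʳ (λ w → f (x ∷ y ∷ w)) v
      ≡⟨ cong (λ q → wt₁ p true * (wt₁ (not p) x * (wt₁ q y * wt (not q) v)) * capʳ (λ w → f (x ∷ y ∷ w)) v) (not-involutive p) ⟩
    wt₁ p true * (wt₁ (not p) x * (wt₁ p y * wt (not p) v)) * capʳ (λ w → f (x ∷ y ∷ w)) v
      ≡⟨ shuffle₁ (wt₁ p true) (wt₁ (not p) x) (wt₁ p y) _ _ ⟩
    wt₁ (not p) x * wt₁ p y * (wt₁ p true * wt (not p) v * capʳ (λ w → f (x ∷ y ∷ w)) v)
      ≡⟨ cong (wt₁ (not p) x * wt₁ p y *_) (go n p (λ w → f (x ∷ y ∷ w)) v) ⟩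
    wt₁ (not p) x * wt₁ p y * (2 * capʳ (wt (not p) ⊙ (λ w → f (x ∷ y ∷ w))) v)
      ≡⟨ shuffle₂ (wt₁ (not p) x * wt₁ p y) _ ⟩
    2 * (wt₁ (not p) x * wt₁ p y * capʳ (wt (not p) ⊙ (λ w → f (x ∷ y ∷ w))) v)
      ≡⟨ cong (2 *_) (sym (scale capʳ-linear (wt₁ (not p) x * wt₁ p y) _ v)) ⟩
    2 * capʳ (wt₁ (not p) x * wt₁ p y · (wt (not p) ⊙ (λ w → f (x ∷ y ∷ w)))) v
      ≡⟨ cong (2 *_) (resp capʳ-linear (λ w → trans (shuffle₃ (wt₁ (not p) x) (wt₁ p y) (wt (not p) w) _)
           (cong (λ q → wt₁ (not p) x * (wt₁ q y * wt (not q) w) * f (x ∷ y ∷ w)) (sym (not-involutive p)))) v) ⟩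
    2 * capʳ (wt (not p) ⊙ f) (x ∷ y ∷ v) ∎
    where
    shuffle₁ : ∀ a b c d e → a * (b * (c * d)) * e ≡ b * c * (a * d * e)
    shuffle₁ = solve-∀
    shuffle₂ : ∀ a b → a * (2 * b) ≡ 2 * (a * b)
    shuffle₂ = solve-∀
    shuffle₃ : ∀ a b c d → a * b * (c * d) ≡ a * (b * c) * d
    shuffle₃ = solve-∀

-- Each of the n weighted places holds a 1 in exactly one of the two sequences.
wt-complement : ∀ n p (v : Seq (dbl n)) → wt p v * wt p (Vec.map not v) ≡ 2 ^ n
wt-complement zero p [] = refl
wt-complement (suc n) p (x ∷ y ∷ v) = begin
  wt₁ p x * (wt₁ (not p) y * wt (not (not p)) v) *
    (wt₁ p (not x) * (wt₁ (not p) (not y) * wt (not (not p)) (Vec.map not v)))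
    ≡⟨ shuffle (wt₁ p x) (wt₁ (not p) y) _ _ _ _ ⟩
  wt₁ p x * wt₁ p (not x) * (wt₁ (not p) y * wt₁ (not p) (not y)) *
    (wt (not (not p)) v * wt (not (not p)) (Vec.map not v))
    ≡⟨ cong₂ _*_ (two p x y) (wt-complement n (not (not p)) v) ⟩
  2 * 2 ^ n ∎
  where
  open ≡-Reasoning
  shuffle : ∀ a b c d e f → a * (b * c) * (d * (e * f)) ≡ a * d * (b * e) * (c * f)
  shuffle = solve-∀
  two : ∀ p x y → wt₁ p x * wt₁ p (not x) * (wt₁ (not p) y * wt₁ (not p) (not y)) ≡ 2
  two false false false = refl
  two false false true = refl
  two false true false = refl
  two false true true = refl
  two true false false = refl
  two true false true = refl
  two true true false = refl
  two true true true = refl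

-- The half diamond as a chain of layers, before and after the exchange.

-- C n, with the value at n = 0 changed to 1.
half : ∀ n → Fn (dbl n)
half zero = λ _ → 1
half (suc n) = row false (cap (flip (half n)))

-- half n with the last factor U_even removed, so that this factor can meet its transpose.
core : ∀ n → Fn (dbl n)
core zero = λ _ → 1
core (suc n) = cap (flip (evens true (evens false (core n))))

-- The odd layer of each row passes `cap` as an even layer and the complement as L; there it meets
-- the even U layer of the next row, while the even layer of the present row stays in front.
half-core : ∀ n → half n ≗ evens false (core n)
half-core zero v = refl
half-core (suc n) v = begin
  row false (cap (flip (half n))) v
    ≡⟨ row-evens-odds false (cap (flip (half n))) v ⟩
  evens false (odds false (cap (flip (half n)))) v
    ≡⟨ resp (evens-linear false) (odds-cap n false _) v ⟩
  evens false (cap (evens false (flip (half n)))) v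
    ≡⟨ resp (evens-linear false) (resp cap-linear (evens-flip false (half n))) v ⟩
  evens false (cap (flip (evens true (half n)))) v
    ≡⟨ resp (evens-linear false) (resp cap-linear (resp (evens-linear true) (half-core n) ∘ Vec.map not)) v ⟩
  evens false (core (suc n)) v ∎
  where open ≡-Reasoning

-- What a half becomes when `spider` is applied at the cut: the L of the exchanged product acts on
-- `core n` with that half's share of the weight. The two halves receive opposite values of p.
opposite : ∀ n p → Fn (dbl n)
opposite n p = evens true (wt p ⊙ core n)

-- The outer weight of `spider` is evaluated at the complement, so together with `wt (not p) v` it
-- gives the constant 2 ^ n, which is the factor on the other side of `spider`.
flip-core : ∀ n p →
  wt (not p) ⊙ flip (evens true (evens false (core n))) ≗ flip (evens false (opposite n p))
flip-core n p v = *-cancelˡ-≡ _ _ (2 ^ n) ⦃ m^n≢0 2 n ⦄ (begin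
  2 ^ n * (wt (not p) v * G (Vec.map not v))
    ≡⟨ shuffle₁ (2 ^ n) (wt (not p) v) (G (Vec.map not v)) ⟩
  wt (not p) v * (2 ^ n * G (Vec.map not v))
    ≡⟨ cong (wt (not p) v *_) (spider n p (core n) (Vec.map not v)) ⟩
  wt (not p) v * (wt (not p) (Vec.map not v) * H (Vec.map not v))
    ≡⟨ sym (*-assoc (wt (not p) v) _ _) ⟩
  wt (not p) v * wt (not p) (Vec.map not v) * H (Vec.map not v)
    ≡⟨ cong (_* H (Vec.map not v)) (wt-complement n (not p) v) ⟩
  2 ^ n * H (Vec.map not v) ∎)
  where
  open ≡-Reasoning
  G H : Fn (dbl n)
  G = evens true (evens false (core n))
  H = evens false (opposite n p)
  shuffle₁ : ∀ a b c → a * (b * c) ≡ b * (a * c)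
  shuffle₁ = solve-∀

-- The 2 comes from `wt-cap`. The even L layer passes `cap` as an odd one and the complement as U,
-- where it joins the even U layer left by `flip-core` to form a full row.
opposite-row : ∀ n p → opposite (suc n) p ≗ 2 · cap (flip (row false (opposite n p)))
opposite-row n p v = begin
  evens true (wt p ⊙ core (suc n)) v
    ≡⟨ resp (evens-linear true) (wt-cap n p _) v ⟩
  evens true (2 · cap (wt (not p) ⊙ flip (evens true (evens false (core n))))) v
    ≡⟨ scale (evens-linear true) 2 _ v ⟩
  2 * evens true (cap (wt (not p) ⊙ flip (evens true (evens false (core n))))) v
    ≡⟨ cong (2 *_) (resp (evens-linear true) (resp cap-linear (flip-core n p)) v) ⟩
  2 * evens true (cap (flip (evens false (opposite n p)))) v
    ≡⟨ cong (2 *_) (evens-cap _ v) ⟩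
  2 * cap (odds true (flip (evens false (opposite n p)))) v
    ≡⟨ cong (2 *_) (resp cap-linear (odds-flip true _) v) ⟩
  2 * cap (flip (odds false (evens false (opposite n p)))) v
    ≡⟨ cong (2 *_) (resp cap-linear (λ w → sym (row-odds-evens false (opposite n p) (Vec.map not w))) v) ⟩
  2 * cap (flip (row false (opposite n p))) v ∎
  where open ≡-Reasoning

-- By `opposite-row`, a row applied to `opposite` obeys the recursion of `half` with an extra 2 per
-- level; in particular p disappears.
row-opposite : ∀ n p → row false (opposite n p) ≗ 2 ^ n · half n
row-opposite zero p [] = refl
row-opposite (suc n) p v = begin
  row false (opposite (suc n) p) v
    ≡⟨ resp (row-linear false) (opposite-row n p) v ⟩
  row false (2 · cap (flip (row false (opposite n p)))) v
    ≡⟨ scale (row-linear false) 2 _ v ⟩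
  2 * row false (cap (flip (row false (opposite n p)))) v
    ≡⟨ cong (2 *_) (resp (row-linear false) (resp cap-linear (row-opposite n p ∘ Vec.map not)) v) ⟩
  2 * row false (cap (2 ^ n · flip (half n))) v
    ≡⟨ cong (2 *_) (scale (∘-linear (row-linear false) cap-linear) (2 ^ n) (flip (half n)) v) ⟩
  2 * (2 ^ n * half (suc n) v)
    ≡⟨ sym (*-assoc 2 (2 ^ n) _) ⟩
  2 ^ suc n * half (suc n) v ∎
  where open ≡-Reasoning

opposite-half : ∀ n p → opposite (suc n) p ≗ 2 ^ suc n · cap (flip (half n))
opposite-half n p v = begin
  opposite (suc n) p v
    ≡⟨ opposite-row n p v ⟩
  2 * cap (flip (row false (opposite n p))) v
    ≡⟨ cong (2 *_) (resp cap-linear (row-opposite n p ∘ Vec.map not) v) ⟩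
  2 * cap (2 ^ n · flip (half n)) v
    ≡⟨ cong (2 *_) (scale cap-linear (2 ^ n) (flip (half n)) v) ⟩
  2 * (2 ^ n * cap (flip (half n)) v)
    ≡⟨ sym (*-assoc 2 (2 ^ n) _) ⟩
  2 ^ suc n * cap (flip (half n)) v ∎
  where open ≡-Reasoning

-- Sums over all sequences, and the recursion for the norm.

total : Fn m → ℕ
total {zero} f = f []
total {suc m} f = total (f ∘ (false ∷_)) + total (f ∘ (true ∷_))

total-cong : {f g : Fn m} → f ≗ g → total f ≡ total g
total-cong {zero} e = e []
total-cong {suc m} e = cong₂ _+_ (total-cong (e ∘ (false ∷_))) (total-cong (e ∘ (true ∷_)))

total-add : (f g : Fn m) → total (f ⊕ g) ≡ total f + total g
total-add {zero} f g = refl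
total-add {suc m} f g = trans (cong₂ _+_ (total-add (f ∘ (false ∷_)) _) (total-add (f ∘ (true ∷_)) _))
  (+-swap (total (f ∘ (false ∷_))) _ _ _)

total-scale : ∀ c (f : Fn m) → total (c · f) ≡ c * total f
total-scale {zero} c f = refl
total-scale {suc m} c f = trans (cong₂ _+_ (total-scale c (f ∘ (false ∷_))) (total-scale c (f ∘ (true ∷_))))
  (sym (*-distribˡ-+ c _ _))

total-zero : total {m} (λ _ → 0) ≡ 0
total-zero {m} = total-scale {m} 0 (λ _ → 0)

total-allSeq : (f : Fn m) → sum (map f (allSeq m)) ≡ total f
total-allSeq {zero} f = +-identityʳ (f [])
total-allSeq {suc m} f = begin
  sum (map f (map (false ∷_) (allSeq m) ++ map (true ∷_) (allSeq m)))
    ≡⟨ cong sum (map-++ f (map (false ∷_) (allSeq m)) _) ⟩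
  sum (map f (map (false ∷_) (allSeq m)) ++ map f (map (true ∷_) (allSeq m)))
    ≡⟨ sum-++ (map f (map (false ∷_) (allSeq m))) _ ⟩
  sum (map f (map (false ∷_) (allSeq m))) + sum (map f (map (true ∷_) (allSeq m)))
    ≡⟨ sym (cong₂ (λ a b → sum a + sum b) (map-∘ (allSeq m)) (map-∘ (allSeq m))) ⟩
  sum (map (f ∘ (false ∷_)) (allSeq m)) + sum (map (f ∘ (true ∷_)) (allSeq m))
    ≡⟨ cong₂ _+_ (total-allSeq (f ∘ (false ∷_))) (total-allSeq (f ∘ (true ∷_))) ⟩
  total f ∎
  where open ≡-Reasoning

evens-adjoint : ∀ m (f g : Fn m) → total (evens false f ⊙ g) ≡ total (f ⊙ evens true g)
evens-adjoint zero f g = refl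
evens-adjoint (suc zero) f g = refl
evens-adjoint (suc (suc m)) f g = begin
  total (λ w → (E 0B 0B w + E 1B 1B w) * g (0B ∷ 0B ∷ w)) + ⟨E,g⟩ 0B 1B + (⟨E,g⟩ 1B 0B + ⟨E,g⟩ 1B 1B)
    ≡⟨ cong (λ z → z + ⟨E,g⟩ 0B 1B + (⟨E,g⟩ 1B 0B + ⟨E,g⟩ 1B 1B)) (trans
         (total-cong (λ w → *-distribʳ-+ (g (0B ∷ 0B ∷ w)) (E 0B 0B w) (E 1B 1B w)))
         (total-add (λ w → E 0B 0B w * g (0B ∷ 0B ∷ w)) (λ w → E 1B 1B w * g (0B ∷ 0B ∷ w)))) ⟩
  ⟨E,g⟩ 0B 0B + total (λ w → E 1B 1B w * g (0B ∷ 0B ∷ w)) + ⟨E,g⟩ 0B 1B + (⟨E,g⟩ 1B 0B + ⟨E,g⟩ 1B 1B)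
    ≡⟨ cong₂ _+_ (cong₂ _+_ (cong₂ _+_ (adj 0B 0B 0B 0B) (adj 1B 1B 0B 0B)) (adj 0B 1B 0B 1B))
         (cong₂ _+_ (adj 1B 0B 1B 0B) (adj 1B 1B 1B 1B)) ⟩
  ⟨f,E⟩ 0B 0B 0B 0B + ⟨f,E⟩ 1B 1B 0B 0B + ⟨f,E⟩ 0B 1B 0B 1B + (⟨f,E⟩ 1B 0B 1B 0B + ⟨f,E⟩ 1B 1B 1B 1B)
    -- The only off-diagonal term, pairing f at 11 with g at 00, moves from the block of 00 to the
    -- block of 11.
    ≡⟨ shuffle (⟨f,E⟩ 0B 0B 0B 0B) (⟨f,E⟩ 1B 1B 0B 0B) (⟨f,E⟩ 0B 1B 0B 1B) (⟨f,E⟩ 1B 0B 1B 0B) (⟨f,E⟩ 1B 1B 1B 1B) ⟩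
  ⟨f,E⟩ 0B 0B 0B 0B + ⟨f,E⟩ 0B 1B 0B 1B + (⟨f,E⟩ 1B 0B 1B 0B + (⟨f,E⟩ 1B 1B 1B 1B + ⟨f,E⟩ 1B 1B 0B 0B))
    ≡⟨ cong (λ z → ⟨f,E⟩ 0B 0B 0B 0B + ⟨f,E⟩ 0B 1B 0B 1B + (⟨f,E⟩ 1B 0B 1B 0B + z)) (sym (trans
         (total-cong (λ w → *-distribˡ-+ (f (1B ∷ 1B ∷ w)) (E′ 1B 1B w) (E′ 0B 0B w)))
         (total-add (λ w → f (1B ∷ 1B ∷ w) * E′ 1B 1B w) (λ w → f (1B ∷ 1B ∷ w) * E′ 0B 0B w)))) ⟩
  total (f ⊙ evens true g) ∎
  where
  open ≡-Reasoning
  0B 1B : Bool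
  0B = false
  1B = true
  E E′ : Bool → Bool → Fn m
  E x y = evens false (λ w → f (x ∷ y ∷ w))
  E′ x y = evens true (λ w → g (x ∷ y ∷ w))
  ⟨E,g⟩ : Bool → Bool → ℕ
  ⟨E,g⟩ x y = total (λ w → E x y w * g (x ∷ y ∷ w))
  ⟨f,E⟩ : Bool → Bool → Bool → Bool → ℕ
  ⟨f,E⟩ x y x′ y′ = total (λ w → f (x ∷ y ∷ w) * E′ x′ y′ w)
  adj : ∀ x y x′ y′ → total (λ w → E x y w * g (x′ ∷ y′ ∷ w)) ≡ ⟨f,E⟩ x y x′ y′
  adj x y x′ y′ = evens-adjoint m (λ w → f (x ∷ y ∷ w)) (λ w → g (x′ ∷ y′ ∷ w))
  shuffle : ∀ a b c d e → a + b + c + (d + e) ≡ a + c + (d + (e + b))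
  shuffle = solve-∀

total-flip : (f : Fn m) → total (flip f) ≡ total f
total-flip {zero} f = refl
total-flip {suc m} f = trans (+-comm (total (λ w → flip f (false ∷ w))) _)
  (cong₂ _+_ (total-flip (f ∘ (false ∷_))) (total-flip (f ∘ (true ∷_))))

-- `cap` copies the values of f to the sequences with a 1 at each end and adds only zeros.
total-cap² : (f : Fn m) → total (cap f ⊙ cap f) ≡ total (f ⊙ f)
total-cap² {m} f = trans (cong (_+ total (capʳ f ⊙ capʳ f)) (total-zero {suc m})) (go f)
  where
  go : ∀ {m} (f : Fn m) → total (capʳ f ⊙ capʳ f) ≡ total (f ⊙ f)
  go {zero} f = refl
  go {suc m} f = cong₂ _+_ (go (f ∘ (false ∷_))) (go (f ∘ (true ∷_)))

-- Transposing the outer U of one half puts L U between two copies of the core. After `spider`,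
-- transposing the new U leaves a product of two `opposite` functions. Each is 2^(n+1) times a copy
-- of the smaller half, and the 2^(n+1) multiplied in for `spider` cancels one of these factors.
norm-step : ∀ n → total (half (suc n) ⊙ half (suc n)) ≡ 2 ^ suc n * total (half n ⊙ half n)
norm-step n = *-cancelˡ-≡ _ _ (2 ^ suc n) ⦃ m^n≢0 2 (suc n) ⦄ (begin
  N * total (half (suc n) ⊙ half (suc n))
    ≡⟨ cong (N *_) (total-cong (λ v → cong₂ _*_ (half-core (suc n) v) (half-core (suc n) v))) ⟩
  N * total (evens false A ⊙ evens false A)
    ≡⟨ cong (N *_) (evens-adjoint (dbl (suc n)) A (evens false A)) ⟩
  N * total (A ⊙ evens true (evens false A))
    ≡⟨ sym (total-scale N (A ⊙ evens true (evens false A))) ⟩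
  total (N · (A ⊙ evens true (evens false A)))
    -- With p = `true`, `spider` leaves `wt true` inside and `wt false` outside; the outer weight is
    -- given to the other copy of `A`, so that each half carries one.
    ≡⟨ total-cong (λ v → trans (shuffle₁ N (A v) _) (trans (cong (A v *_) (spider (suc n) true A v))
         (shuffle₂ (A v) (wt false v) _))) ⟩
  total (evens false (opposite (suc n) true) ⊙ (wt false ⊙ A))
    ≡⟨ evens-adjoint (dbl (suc n)) (opposite (suc n) true) (wt false ⊙ A) ⟩
  total (opposite (suc n) true ⊙ opposite (suc n) false)
    ≡⟨ total-cong (λ v → trans (cong₂ _*_ (opposite-half n true v) (opposite-half n false v))
         (shuffle₃ N (B v))) ⟩
  total (N · (N · (B ⊙ B)))
    ≡⟨ trans (total-scale N (N · (B ⊙ B))) (cong (N *_) (total-scale N (B ⊙ B))) ⟩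
  N * (N * total (B ⊙ B))
    ≡⟨ cong (λ z → N * (N * z)) (trans (total-cap² (flip (half n))) (total-flip (half n ⊙ half n))) ⟩
  N * (N * total (half n ⊙ half n)) ∎)
  where
  open ≡-Reasoning
  N = 2 ^ suc n
  A B : Fn (dbl (suc n))
  A = core (suc n)
  B = cap (flip (half n))
  shuffle₁ : ∀ a b c → a * (b * c) ≡ b * (a * c)
  shuffle₁ = solve-∀
  shuffle₂ : ∀ a b c → a * (b * c) ≡ c * (b * a)
  shuffle₂ = solve-∀
  shuffle₃ : ∀ a b → a * b * (a * b) ≡ a * (a * (b * b))
  shuffle₃ = solve-∀

-- The operators of the definition of C

eval : Lin m → Fn m → ℕ
eval xs f = sum (map f xs)

eval-cong : ∀ (xs : Lin m) {f g : Fn m} → f ≗ g → eval xs f ≡ eval xs g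
eval-cong xs e = cong sum (map-cong e xs)

eval-concatMap : (T : Seq m → Lin k) (xs : Lin m) (f : Fn k) →
  eval (concatMap T xs) f ≡ eval xs (λ v → eval (T v) f)
eval-concatMap T [] f = refl
eval-concatMap T (x ∷ xs) f = begin
  sum (map f (T x ++ concatMap T xs))
    ≡⟨ cong sum (map-++ f (T x) _) ⟩
  sum (map f (T x) ++ map f (concatMap T xs))
    ≡⟨ sum-++ (map f (T x)) _ ⟩
  eval (T x) f + eval (concatMap T xs) f
    ≡⟨ cong (eval (T x) f +_) (eval-concatMap T xs f) ⟩
  eval (x ∷ xs) (λ v → eval (T v) f) ∎
  where open ≡-Reasoning

estep : ℕ → Fn m → Fn m
estep i f v = eval (Estep i v) f

estep-cong : ∀ i {f g : Fn m} → f ≗ g → estep i f ≗ estep i g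
estep-cong i e v = eval-cong (Estep i v) e

estep-zero : (f : Fn (suc (suc m))) → estep zero f ≗ hop false f
estep-zero f (false ∷ false ∷ v) = cong (f (false ∷ false ∷ v) +_) (+-identityʳ _)
estep-zero f (false ∷ true ∷ v) = +-identityʳ _
estep-zero f (true ∷ y ∷ v) = +-identityʳ _

estep-suc : ∀ i (f : Fn (suc m)) → estep (suc i) f ≗ skip (estep i) f
estep-suc i f (x ∷ v) = cong sum (sym (map-∘ (Estep i v)))

-- Pulling functions back reverses composition, so the `foldl` of `Elin` turns into a `foldr`.
esteps : List ℕ → Fn m → Fn m
esteps is f = foldr estep f is

esteps-suc : ∀ is (f : Fn (suc m)) → esteps (map suc is) f ≗ skip (esteps is) f
esteps-suc [] f (x ∷ v) = refl
esteps-suc (i ∷ is) f v = trans (estep-cong (suc i) (esteps-suc is f) v)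
  (trans (estep-suc i (skip (esteps is) f) v) (sym (skip-∘ (estep i) (esteps is) f v)))

esteps-row : (f : Fn (suc m)) → esteps (upTo m) f ≗ row false f
esteps-row {zero} f v = refl
esteps-row {suc m} f v = begin
  estep zero (esteps (applyUpTo suc m) f) v
    ≡⟨ estep-zero (esteps (applyUpTo suc m) f) v ⟩
  hop false (esteps (applyUpTo suc m) f) v
    ≡⟨ cong (λ is → hop false (esteps is f) v) (sym (map-upTo suc m)) ⟩
  hop false (esteps (map suc (upTo m)) f) v
    ≡⟨ resp (hop-linear false) (λ w → trans (esteps-suc (upTo m) f w) (skip-cong esteps-row f w)) v ⟩
  row false f v ∎
  where open ≡-Reasoning

eval-Elin : (xs : Lin (suc m)) (f : Fn (suc m)) → eval (Elin xs) f ≡ eval xs (row false f)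
eval-Elin {m} xs f = trans (go (upTo m) xs f) (eval-cong xs (esteps-row f))
  where
  go : ∀ is (xs : Lin (suc m)) f →
    eval (foldl (λ acc i → concatMap (Estep i) acc) xs is) f ≡ eval xs (esteps is f)
  go [] xs f = refl
  go (i ∷ is) xs f = trans (go is (concatMap (Estep i) xs) f)
    (eval-concatMap (Estep i) xs (esteps is f))

-- The rule of `K` at the right end, as an operation on functions.
close : Vec Bool k × Bool × Bool → Fn (suc k) → ℕ
close (mid , true , false) h = 0
close (mid , a , b) h = h (mid ∷ʳ (if not a ∧ b then false else true))

row-capʳ : ∀ x (v : Seq (suc (suc k))) (g : Fn (suc (suc k))) →
  row false (capʳ g) (x ∷ v) ≡ close (lastTwo v) (λ u → row false g (x ∷ u))
row-capʳ {zero} false (false ∷ false ∷ []) g = +-identityʳ _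
row-capʳ {zero} false (false ∷ true ∷ []) g = refl
row-capʳ {zero} false (true ∷ false ∷ []) g = refl
row-capʳ {zero} false (true ∷ true ∷ []) g = refl
row-capʳ {zero} true (false ∷ false ∷ []) g = refl
row-capʳ {zero} true (false ∷ true ∷ []) g = refl
row-capʳ {zero} true (true ∷ false ∷ []) g = refl
row-capʳ {zero} true (true ∷ true ∷ []) g = refl
-- The hop on the first two entries may turn y into 1, so the induction hypothesis is needed for y
-- and for `true`; the last two entries are the same in both.
row-capʳ {suc k} x (y ∷ v) g with lastTwo v | row-capʳ y v | row-capʳ true v
row-capʳ {suc k} false (false ∷ v) g | mid , true , false | ih | ih₁ = cong₂ _+_ (ih (g ∘ (false ∷_))) (ih₁ (g ∘ (true ∷_)))
row-capʳ {suc k} false (false ∷ v) g | mid , true , true | ih | ih₁ = cong₂ _+_ (ih (g ∘ (false ∷_))) (ih₁ (g ∘ (true ∷_)))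
row-capʳ {suc k} false (false ∷ v) g | mid , false , b | ih | ih₁ = cong₂ _+_ (ih (g ∘ (false ∷_))) (ih₁ (g ∘ (true ∷_)))
row-capʳ {suc k} false (true ∷ v) g | mid , true , false | ih | _ = ih (g ∘ (false ∷_))
row-capʳ {suc k} false (true ∷ v) g | mid , true , true | ih | _ = ih (g ∘ (false ∷_))
row-capʳ {suc k} false (true ∷ v) g | mid , false , b | ih | _ = ih (g ∘ (false ∷_))
row-capʳ {suc k} true (y ∷ v) g | mid , true , false | ih | _ = ih (g ∘ (true ∷_))
row-capʳ {suc k} true (y ∷ v) g | mid , true , true | ih | _ = ih (g ∘ (true ∷_))
row-capʳ {suc k} true (y ∷ v) g | mid , false , b | ih | _ = ih (g ∘ (true ∷_))

-- Under `cap` an end entry 0 survives only if paired with a neighbouring 0. The neighbour then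
-- becomes the end of the shorter row: with value 1 after such a pairing, with its own value after
-- an end entry 1. These are the cases of `K`, so `K` and then the shorter row amount to the longer
-- row and then deletion of its ends.
eval-K : (v : Seq (suc (suc (suc (suc k))))) (g : Fn (suc (suc k))) →
  eval (K v) (row false g) ≡ row false (cap g) v
eval-K (x ∷ y ∷ v) g with lastTwo v | row-capʳ y v g | row-capʳ true v g
eval-K (false ∷ true ∷ v) g | _ | _ | _ = sym (null (row-linear false) (true ∷ v))
eval-K (false ∷ false ∷ v) g | mid , true , false | _ | e = sym (cong₂ _+_ (null (row-linear false) (false ∷ v)) e)
eval-K (false ∷ false ∷ v) g | mid , true , true | _ | e = trans (+-identityʳ _) (sym (cong₂ _+_ (null (row-linear false) (false ∷ v)) e))
eval-K (false ∷ false ∷ v) g | mid , false , b | _ | e = trans (+-identityʳ _) (sym (cong₂ _+_ (null (row-linear false) (false ∷ v)) e))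
eval-K (true ∷ y ∷ v) g | mid , true , false | e | _ = sym e
eval-K (true ∷ false ∷ v) g | mid , true , true | e | _ = trans (+-identityʳ _) (sym e)
eval-K (true ∷ true ∷ v) g | mid , true , true | e | _ = trans (+-identityʳ _) (sym e)
eval-K (true ∷ false ∷ v) g | mid , false , b | e | _ = trans (+-identityʳ _) (sym e)
eval-K (true ∷ true ∷ v) g | mid , false , b | e | _ = trans (+-identityʳ _) (sym e)

C-half : ∀ n → C (suc n) ≗ half (suc n)
C-half zero (false ∷ false ∷ []) = refl
C-half zero (false ∷ true ∷ []) = refl
C-half zero (true ∷ false ∷ []) = refl
C-half zero (true ∷ true ∷ []) = refl
C-half (suc n) v = begin
  eval (concatMap R (Elin (K v))) (C (suc n))
    ≡⟨ eval-concatMap R (Elin (K v)) (C (suc n)) ⟩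
  eval (Elin (K v)) (λ w → C (suc n) (Vec.map not w) + 0)
    ≡⟨ eval-cong (Elin (K v)) (λ w → trans (+-identityʳ _) (C-half n (Vec.map not w))) ⟩
  eval (Elin (K v)) (flip (half (suc n)))
    ≡⟨ eval-Elin (K v) (flip (half (suc n))) ⟩
  eval (K v) (row false (flip (half (suc n))))
    ≡⟨ eval-K v (flip (half (suc n))) ⟩
  half (suc (suc n)) v ∎
  where open ≡-Reasoning

normC-half : ∀ n → normC (suc n) ≡ total (half (suc n) ⊙ half (suc n))
normC-half n = trans (total-allSeq (λ v → C (suc n) v * C (suc n) v))
  (total-cong (λ v → cong₂ _*_ (C-half n v) (C-half n v)))

-- Counting exact covers

Cover : Set
Cover = Cell → ℕ

hit : Cell → Cover
hit a c = if eqCell c a then 1 else 0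

hit-≡ : ∀ {a c} → c ≡ a → hit a c ≡ 1
hit-≡ {i , j} refl with i ℤ.≟ i | j ℤ.≟ j
... | yes _ | yes _ = refl
... | yes _ | no ≢ = contradiction refl ≢
... | no ≢ | _ = contradiction refl ≢

hit-≢ : ∀ {a c} → c ≢ a → hit a c ≡ 0
hit-≢ {i , j} {i′ , j′} c≢a with i′ ℤ.≟ i | j′ ℤ.≟ j
... | yes refl | yes refl = contradiction refl c≢a
... | yes _ | no _ = refl
... | no _ | _ = refl

cover : Domino → Cover
cover (a , b) c = hit a c + hit b c

infixr 5 _◂_
_◂_ : Domino → Cover → Cover
(d ◂ p) c = cover d c + p c

untouched : ∀ d p {c} → cover d c ≡ 0 → (d ◂ p) c ≡ p c
untouched d p {c} e = cong (_+ p c) e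

exact : List Cell → Cover → ℕ
exact [] p = 1
exact (c ∷ cs) p = if p c ≡ᵇ 1 then exact cs p else 0

-- p counts how often each cell is already covered.
tilings : List Cell → List Domino → Cover → ℕ
tilings cs [] p = exact cs p
tilings cs (d ∷ ds) p = tilings cs ds p + tilings cs ds (d ◂ p)

exact-congˡ : ∀ cs {p p′} → All (λ c → p c ≡ p′ c) cs → exact cs p ≡ exact cs p′
exact-congˡ [] [] = refl
exact-congˡ (c ∷ cs) (e ∷ es) = cong₂ (λ a b → if a ≡ᵇ 1 then b else 0) e (exact-congˡ cs es)

exact-↭ : ∀ {cs cs′} p → cs ↭ cs′ → exact cs p ≡ exact cs′ p
exact-↭ p ↭.refl = refl
exact-↭ p (prep c e) = cong (λ b → if p c ≡ᵇ 1 then b else 0) (exact-↭ p e)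
exact-↭ p (swap c c′ e) with p c ≡ᵇ 1 | p c′ ≡ᵇ 1
... | true  | true  = exact-↭ p e
... | true  | false = refl
... | false | true  = refl
... | false | false = refl
exact-↭ p (↭.trans e e′) = trans (exact-↭ p e) (exact-↭ p e′)

tilings-congˡ : ∀ cs ds {p p′} → All (λ c → p c ≡ p′ c) cs → tilings cs ds p ≡ tilings cs ds p′
tilings-congˡ cs [] es = exact-congˡ cs es
tilings-congˡ cs (d ∷ ds) es = cong₂ _+_ (tilings-congˡ cs ds es)
  (tilings-congˡ cs ds (All.map (λ {c} → cong (cover d c +_)) es))

tilings-cong : ∀ cs ds {p p′} → p ≗ p′ → tilings cs ds p ≡ tilings cs ds p′
tilings-cong cs ds e = tilings-congˡ cs ds (All.universal e cs)

tilings-↭ˡ : ∀ {cs cs′} ds p → cs ↭ cs′ → tilings cs ds p ≡ tilings cs′ ds p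
tilings-↭ˡ [] p e = exact-↭ p e
tilings-↭ˡ (d ∷ ds) p e = cong₂ _+_ (tilings-↭ˡ ds p e) (tilings-↭ˡ ds (d ◂ p) e)

tilings-↭ʳ : ∀ cs {ds ds′} p → ds ↭ ds′ → tilings cs ds p ≡ tilings cs ds′ p
tilings-↭ʳ cs p ↭.refl = refl
tilings-↭ʳ cs p (prep d e) = cong₂ _+_ (tilings-↭ʳ cs p e) (tilings-↭ʳ cs (d ◂ p) e)
tilings-↭ʳ cs {_} {_ ∷ _ ∷ ds′} p (swap d d′ e) = begin
  _ ≡⟨ cong₂ _+_ (cong₂ _+_ (tilings-↭ʳ cs p e) (tilings-↭ʳ cs (d′ ◂ p) e))
         (cong₂ _+_ (tilings-↭ʳ cs (d ◂ p) e) (tilings-↭ʳ cs (d′ ◂ d ◂ p) e)) ⟩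
  t p + t (d′ ◂ p) + (t (d ◂ p) + t (d′ ◂ d ◂ p))
    ≡⟨ +-swap (t p) (t (d′ ◂ p)) (t (d ◂ p)) _ ⟩
  t p + t (d ◂ p) + (t (d′ ◂ p) + t (d′ ◂ d ◂ p))
    ≡⟨ cong (λ z → t p + t (d ◂ p) + (t (d′ ◂ p) + z))
         (tilings-cong cs ds′ (λ c → exchange (cover d′ c) (cover d c) (p c))) ⟩
  t p + t (d ◂ p) + (t (d′ ◂ p) + t (d ◂ d′ ◂ p)) ∎
  where
  open ≡-Reasoning
  t : Cover → ℕ
  t = tilings cs ds′
  exchange : ∀ a b c → a + (b + c) ≡ b + (a + c)
  exchange = solve-∀
tilings-↭ʳ cs p (↭.trans e e′) = trans (tilings-↭ʳ cs p e) (tilings-↭ʳ cs p e′)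

Avoids : List Domino → Cell → Set
Avoids ds c = All (λ d → cover d c ≡ 0) ds

-- The coverage of a cell that no remaining domino touches is final, so its test can be made before
-- the remaining choices.
tilings-settle : ∀ c cs ds p → Avoids ds c →
  tilings (c ∷ cs) ds p ≡ (if p c ≡ᵇ 1 then tilings cs ds p else 0)
tilings-settle c cs [] p [] = refl
tilings-settle c cs (d ∷ ds) p (e ∷ es) = begin
  tilings (c ∷ cs) ds p + tilings (c ∷ cs) ds (d ◂ p)
    ≡⟨ cong₂ _+_ (tilings-settle c cs ds p es) (tilings-settle c cs ds (d ◂ p) es) ⟩
  (if p c ≡ᵇ 1 then tilings cs ds p else 0) +
    (if cover d c + p c ≡ᵇ 1 then tilings cs ds (d ◂ p) else 0)
    ≡⟨ cong (λ z → (if p c ≡ᵇ 1 then tilings cs ds p else 0) +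
         (if z + p c ≡ᵇ 1 then tilings cs ds (d ◂ p) else 0)) e ⟩
  (if p c ≡ᵇ 1 then tilings cs ds p else 0) + (if p c ≡ᵇ 1 then tilings cs ds (d ◂ p) else 0)
    ≡⟨ merge (p c ≡ᵇ 1) _ _ ⟩
  (if p c ≡ᵇ 1 then tilings cs (d ∷ ds) p else 0) ∎
  where
  open ≡-Reasoning
  merge : ∀ b x y → (if b then x else 0) + (if b then y else 0) ≡ (if b then x + y else 0)
  merge true x y = refl
  merge false x y = refl

settle-1 : ∀ {c cs ds p} → Avoids ds c → p c ≡ 1 → tilings (c ∷ cs) ds p ≡ tilings cs ds p
settle-1 {c} {cs} {ds} {p} av e = trans (tilings-settle c cs ds p av)
  (cong (λ z → if z ≡ᵇ 1 then tilings cs ds p else 0) e)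

settle-0 : ∀ {c cs ds p} → Avoids ds c → p c ≡ 0 → tilings (c ∷ cs) ds p ≡ 0
settle-0 {c} {cs} {ds} {p} av e = trans (tilings-settle c cs ds p av)
  (cong (λ z → if z ≡ᵇ 1 then tilings cs ds p else 0) e)

-- Coverage only grows, so a double cover is fatal whatever dominoes follow.
overlap-0 : ∀ {c} {cs} ds {p} → 2 ≤ p c → tilings (c ∷ cs) ds p ≡ 0
overlap-0 {c} {cs} [] {p} 2≤p with p c | 2≤p
... | suc (suc _) | s≤s (s≤s _) = refl
overlap-0 (d ∷ ds) 2≤p = cong₂ _+_ (overlap-0 ds 2≤p) (overlap-0 ds (≤-trans 2≤p (m≤n+m _ _)))

-- Neither list of dominoes affects the tests on the other's cells, so the choices are independent.
tilings-++ : ∀ cs₁ cs₂ ds₁ ds₂ p → All (Avoids ds₁) cs₂ → All (Avoids ds₂) cs₁ →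
  tilings (cs₁ ++ cs₂) (ds₁ ++ ds₂) p ≡ tilings cs₁ ds₁ p * tilings cs₂ ds₂ p
tilings-++ [] cs₂ [] ds₂ p a₁ a₂ = sym (*-identityˡ _)
tilings-++ (c ∷ cs₁) cs₂ [] ds₂ p a₁ (a ∷ a₂) = begin
  tilings (c ∷ cs₁ ++ cs₂) ds₂ p
    ≡⟨ tilings-settle c (cs₁ ++ cs₂) ds₂ p a ⟩
  (if p c ≡ᵇ 1 then tilings (cs₁ ++ cs₂) ds₂ p else 0)
    ≡⟨ cong (λ z → if p c ≡ᵇ 1 then z else 0) (tilings-++ cs₁ cs₂ [] ds₂ p a₁ a₂) ⟩
  (if p c ≡ᵇ 1 then exact cs₁ p * tilings cs₂ ds₂ p else 0)
    ≡⟨ factor (p c ≡ᵇ 1) _ _ ⟩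
  exact (c ∷ cs₁) p * tilings cs₂ ds₂ p ∎
  where
  open ≡-Reasoning
  factor : ∀ b x y → (if b then x * y else 0) ≡ (if b then x else 0) * y
  factor true x y = refl
  factor false x y = refl
tilings-++ cs₁ cs₂ (d ∷ ds₁) ds₂ p a₁ a₂ = begin
  tilings (cs₁ ++ cs₂) (ds₁ ++ ds₂) p + tilings (cs₁ ++ cs₂) (ds₁ ++ ds₂) (d ◂ p)
    ≡⟨ cong₂ _+_ (tilings-++ cs₁ cs₂ ds₁ ds₂ p a₁′ a₂) (tilings-++ cs₁ cs₂ ds₁ ds₂ (d ◂ p) a₁′ a₂) ⟩
  tilings cs₁ ds₁ p * tilings cs₂ ds₂ p + tilings cs₁ ds₁ (d ◂ p) * tilings cs₂ ds₂ (d ◂ p)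
    ≡⟨ cong (λ z → tilings cs₁ ds₁ p * tilings cs₂ ds₂ p + tilings cs₁ ds₁ (d ◂ p) * z)
         (tilings-congˡ cs₂ ds₂ (All.map (λ {c} av → cong (_+ p c) (All.head av)) a₁)) ⟩
  tilings cs₁ ds₁ p * tilings cs₂ ds₂ p + tilings cs₁ ds₁ (d ◂ p) * tilings cs₂ ds₂ p
    ≡⟨ sym (*-distribʳ-+ (tilings cs₂ ds₂ p) (tilings cs₁ ds₁ p) _) ⟩
  tilings cs₁ (d ∷ ds₁) p * tilings cs₂ ds₂ p ∎
  where
  open ≡-Reasoning
  a₁′ = All.map All.tail a₁

all-cong : ∀ {f g : Cell → Bool} → f ≗ g → ∀ cs → allL f cs ≡ allL g cs
all-cong e [] = refl
all-cong e (c ∷ cs) = cong₂ _∧_ (e c) (all-cong e cs)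

count-map : ∀ {A B : Set} {q : B → Bool} {q′ : A → Bool} {f : A → B} → (∀ s → q (f s) ≡ q′ s) → ∀ S →
  length (filter (λ s → q s ≟B true) (map f S)) ≡ length (filter (λ s → q′ s ≟B true) S)
count-map e [] = refl
count-map {q = q} {q′} {f} e (s ∷ S) with q (f s) | q′ s | e s
... | true | true | refl = cong suc (count-map e S)
... | false | false | refl = count-map e S

-- An arbitrary initial cover p lets the induction absorb a chosen first domino into p.
count-subsets : ∀ cs ds p →
  length (filter (λ s → allL (λ c → (coverCount c ds s + p c) ≡ᵇ 1) cs ≟B true) (allSubsets (length ds)))
  ≡ tilings cs ds p
count-subsets cs [] p = go cs
  where
  go : ∀ cs → length (filter (λ s → allL (λ c → (coverCount c [] s + p c) ≡ᵇ 1) cs ≟B true) ([] ∷ [])) ≡ exact cs p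
  go [] = refl
  go (c ∷ cs) with p c ≡ᵇ 1
  ... | true = go cs
  ... | false = refl
count-subsets cs (d ∷ ds) p = begin
  length (filter (P p (d ∷ ds)) (map (false ∷_) S ++ map (true ∷_) S))
    ≡⟨ cong length (filter-++ (P p (d ∷ ds)) (map (false ∷_) S) _) ⟩
  length (filter (P p (d ∷ ds)) (map (false ∷_) S) ++ filter (P p (d ∷ ds)) (map (true ∷_) S))
    ≡⟨ length-++ (filter (P p (d ∷ ds)) (map (false ∷_) S)) ⟩
  length (filter (P p (d ∷ ds)) (map (false ∷_) S)) + length (filter (P p (d ∷ ds)) (map (true ∷_) S))
    ≡⟨ cong₂ _+_ (count-map (λ s → refl) S)
         (count-map (λ s → all-cong (λ c → cong (_≡ᵇ 1) (shuffle (cover d c) (coverCount c ds s) (p c))) cs) S) ⟩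
  length (filter (P p ds) S) + length (filter (P (d ◂ p) ds) S)
    ≡⟨ cong₂ _+_ (count-subsets cs ds p) (count-subsets cs ds (d ◂ p)) ⟩
  tilings cs (d ∷ ds) p ∎
  where
  open ≡-Reasoning
  S = allSubsets (length ds)
  Q : Cover → List Domino → List Bool → Bool
  Q p ds s = allL (λ c → (coverCount c ds s + p c) ≡ᵇ 1) cs
  P = λ p ds s → Q p ds s ≟B true
  shuffle : ∀ a b c → a + b + c ≡ b + (a + c)
  shuffle = solve-∀

numTilings-tilings : ∀ n → numTilings n ≡ tilings (cells n) (dominoes n) (λ _ → 0)
numTilings-tilings n = trans
  (trans (cong (λ S → length (filter (λ s → isTiling n s ≟B true) S)) (sym (map-id S)))
    (count-map (λ s → all-cong (λ c → cong (_≡ᵇ 1) (sym (+-identityʳ (coverCount c (dominoes n) s)))) (cells n)) S))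
  (count-subsets (cells n) (dominoes n) (λ _ → 0))
  where S = allSubsets (length (dominoes n))

-- The two halves of the diamond

bit : Bool → ℕ
bit b = if b then 1 else 0

Inside : ℕ → ℕ → ℕ → Set
Inside n t q = t ≤ q × q + t < dbl n

-- In order m + t, the positions of row 0 split into t cells, the 2m positions of row t, and t more
-- cells.
dbl-+ : ∀ m t → dbl (m + t) ≡ t + dbl m + t
dbl-+ zero t = go t
  where
  go : ∀ t → dbl t ≡ t + 0 + t
  go zero = refl
  go (suc t) = cong suc (trans (cong suc (go t)) (sym (+-suc (t + 0) t)))
dbl-+ (suc m) t = trans (cong (suc ∘ suc) (dbl-+ m t))
  (cong (_+ t) (sym (trans (+-suc t (suc (dbl m))) (cong suc (+-suc t (dbl m))))))

outside : ∀ {n t q} → n ≤ t → ¬ Inside n t q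
outside {n} n≤t (t≤q , lt) = <⇒≱ lt
  (subst (_≤ _) (sym (trans (dbl-+ 0 n) (cong (_+ n) (+-identityʳ n)))) (+-mono-≤ (≤-trans n≤t t≤q) n≤t))

unbound : ∀ m {t q} → suc q + t < dbl (suc m + t) → q < suc t + dbl m
unbound m {t} {q} lt = subst (q <_) (+-suc t (dbl m)) (s<s⁻¹ (subst (suc q <_) (+-suc t (suc (dbl m)))
  (+-cancelʳ-< t (suc q) _ (subst (suc q + t <_) (dbl-+ (suc m) t) lt))))

<-shift : ∀ {q′} q k → q′ < q + suc k → q′ < suc q + k
<-shift {q′} q k = subst (q′ <_) (+-suc q k)

<-empty : ∀ {q′} q → q′ < q + 0 → ¬ q ≤ q′
<-empty {q′} q lt = <⇒≱ (subst (q′ <_) (+-identityʳ q) lt)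

-- site b t q is the cell of the half b (true on the far side of the cut in the i-direction) at
-- distance t from the cut; q is its position, so that row t consists of t ≤ q < 2n − t.
module Sites
  (site : Bool → ℕ → ℕ → Cell)
  (site-injective : ∀ {b t q b′ t′ q′} → site b t q ≡ site b′ t′ q′ → b ≡ b′ × t ≡ t′ × q ≡ q′)
  where

  along : Bool → ℕ → ℕ → Domino
  along b t q = site b t q , site b t (suc q)

  -- On either side the cell with the smaller first coordinate comes first, as in the pairs listed
  -- by `dominoes`.
  outward : Bool → ℕ → ℕ → Domino
  outward true  t q = site true t q , site true (suc t) q
  outward false t q = site false (suc t) q , site false t q

  across : ℕ → Domino
  across q = site false 0 q , site true 0 q

  hit-here : ∀ b t q → hit (site b t q) (site b t q) ≡ 1
  hit-here b t q = hit-≡ {site b t q} refl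

  hit-side : ∀ {b t q b′ t′ q′} → b ≢ b′ → hit (site b t q) (site b′ t′ q′) ≡ 0
  hit-side b≢ = hit-≢ (λ e → b≢ (sym (proj₁ (site-injective e))))

  hit-depth : ∀ {b t q b′ t′ q′} → t ≢ t′ → hit (site b t q) (site b′ t′ q′) ≡ 0
  hit-depth t≢ = hit-≢ (λ e → t≢ (sym (proj₁ (proj₂ (site-injective e)))))

  hit-position : ∀ {b t q b′ t′ q′} → q ≢ q′ → hit (site b t q) (site b′ t′ q′) ≡ 0
  hit-position q≢ = hit-≢ (λ e → q≢ (sym (proj₂ (proj₂ (site-injective e)))))

  cover-outward : ∀ b t q c → cover (outward b t q) c ≡ hit (site b t q) c + hit (site b (suc t) q) c
  cover-outward true t q c = refl
  cover-outward false t q c = +-comm (hit (site false (suc t) q) c) _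

  along-covers : ∀ b t q → cover (along b t q) (site b t q) ≡ 1
  along-covers b t q = cong₂ _+_ (hit-here b t q) (hit-position 1+n≢n)

  along-covers-next : ∀ b t q → cover (along b t q) (site b t (suc q)) ≡ 1
  along-covers-next b t q = cong₂ _+_ (hit-position (1+n≢n ∘ sym)) (hit-here b t (suc q))

  outward-covers : ∀ b t q → cover (outward b t q) (site b t q) ≡ 1
  outward-covers b t q = trans (cover-outward b t q (site b t q)) (cong₂ _+_ (hit-here b t q) (hit-depth 1+n≢n))

  outward-covers-next : ∀ b t q → cover (outward b t q) (site b (suc t) q) ≡ 1
  outward-covers-next b t q = trans (cover-outward b t q (site b (suc t) q))
    (cong₂ _+_ (hit-depth (1+n≢n ∘ sym)) (hit-here b (suc t) q))

  across-covers : ∀ b q → cover (across q) (site b 0 q) ≡ 1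
  across-covers false q = cong₂ _+_ (hit-here false 0 q) (hit-side (λ ()))
  across-covers true q = cong₂ _+_ (hit-side (λ ())) (hit-here true 0 q)

  rowCells : Bool → ℕ → ℕ → ℕ → List Cell
  rowCells b t q zero = []
  rowCells b t q (suc k) = site b t q ∷ rowCells b t (suc q) k

  -- The order matters: after the two dominoes listed for position q, no later one covers the row's
  -- cell there.
  rowDominoes : Bool → ℕ → ℕ → ℕ → List Domino
  rowDominoes b t q zero = []
  rowDominoes b t q (suc k) = along b t q ∷ outward b t q ∷ rowDominoes b t (suc q) k

  halfCells : Bool → ℕ → ℕ → ℕ → List Cell
  halfCells b zero t q = []
  halfCells b (suc n) t q = rowCells b t q (dbl (suc n)) ++ halfCells b n (suc t) (suc q)

  -- The next row is shorter by one cell at each end, so the end cells have no `outward` domino.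
  halfDominoes : Bool → ℕ → ℕ → ℕ → List Domino
  halfDominoes b zero t q = []
  halfDominoes b (suc n) t q =
    along b t q ∷ rowDominoes b t (suc q) (dbl n) ++ halfDominoes b n (suc t) (suc q)

  cutDominoes : ℕ → ℕ → List Domino
  cutDominoes q zero = []
  cutDominoes q (suc k) = across q ∷ cutDominoes (suc q) k

  along-avoids-depth : ∀ {b t q b′ t′ q′} → t ≢ t′ → cover (along b t q) (site b′ t′ q′) ≡ 0
  along-avoids-depth t≢ = cong₂ _+_ (hit-depth t≢) (hit-depth t≢)

  along-avoids-position : ∀ {b t q b′ t′ q′} → q ≢ q′ → suc q ≢ q′ → cover (along b t q) (site b′ t′ q′) ≡ 0
  along-avoids-position q≢ 1+q≢ = cong₂ _+_ (hit-position q≢) (hit-position 1+q≢)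

  outward-avoids-depth : ∀ b t q {b′ t′ q′} → t ≢ t′ → suc t ≢ t′ → cover (outward b t q) (site b′ t′ q′) ≡ 0
  outward-avoids-depth b t q {b′} {t′} {q′} t≢ 1+t≢ = trans (cover-outward b t q (site b′ t′ q′)) (cong₂ _+_ (hit-depth t≢) (hit-depth 1+t≢))

  outward-avoids-position : ∀ b t q {b′ t′ q′} → q ≢ q′ → cover (outward b t q) (site b′ t′ q′) ≡ 0
  outward-avoids-position b t q {b′} {t′} {q′} q≢ = trans (cover-outward b t q (site b′ t′ q′))
    (cong₂ _+_ (hit-position q≢) (hit-position q≢))

  rowDominoes-avoid-position : ∀ {b t b′ t′} q k {q′} → q′ < q → Avoids (rowDominoes b t q k) (site b′ t′ q′)
  rowDominoes-avoid-position q zero q′<q = []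
  rowDominoes-avoid-position {b} {t} q (suc k) q′<q =
    along-avoids-position (>⇒≢ q′<q) (>⇒≢ (m<n⇒m<1+n q′<q)) ∷ outward-avoids-position b t q (>⇒≢ q′<q) ∷
    rowDominoes-avoid-position (suc q) k (m<n⇒m<1+n q′<q)

  rowDominoes-avoid-depth : ∀ {b t b′ t′} q k {q′} → t′ < t → Avoids (rowDominoes b t q k) (site b′ t′ q′)
  rowDominoes-avoid-depth q zero t′<t = []
  rowDominoes-avoid-depth {b} {t} q (suc k) t′<t =
    along-avoids-depth (>⇒≢ t′<t) ∷ outward-avoids-depth b t q (>⇒≢ t′<t) (>⇒≢ (m<n⇒m<1+n t′<t)) ∷
    rowDominoes-avoid-depth (suc q) k t′<t

  halfDominoes-avoid-depth : ∀ {b} n {t b′ t′ q q′} → t′ < t → Avoids (halfDominoes b n t q) (site b′ t′ q′)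
  halfDominoes-avoid-depth zero t′<t = []
  halfDominoes-avoid-depth (suc n) t′<t = along-avoids-depth (>⇒≢ t′<t) ∷
    All.++⁺ (rowDominoes-avoid-depth _ (dbl n) t′<t) (halfDominoes-avoid-depth n (m<n⇒m<1+n t′<t))

  along-avoids-side : ∀ {b t q b′ t′ q′} → b ≢ b′ → cover (along b t q) (site b′ t′ q′) ≡ 0
  along-avoids-side b≢ = cong₂ _+_ (hit-side b≢) (hit-side b≢)

  outward-avoids-side : ∀ b t q {b′ t′ q′} → b ≢ b′ → cover (outward b t q) (site b′ t′ q′) ≡ 0
  outward-avoids-side b t q {b′} {t′} {q′} b≢ = trans (cover-outward b t q (site b′ t′ q′)) (cong₂ _+_ (hit-side b≢) (hit-side b≢))

  rowDominoes-avoid-side : ∀ {b t b′ t′} q k {q′} → b ≢ b′ → Avoids (rowDominoes b t q k) (site b′ t′ q′)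
  rowDominoes-avoid-side q zero b≢ = []
  rowDominoes-avoid-side {b} {t} q (suc k) b≢ =
    along-avoids-side b≢ ∷ outward-avoids-side b t q b≢ ∷ rowDominoes-avoid-side (suc q) k b≢

  halfDominoes-avoid-side : ∀ {b} n {t b′ t′ q q′} → b ≢ b′ → Avoids (halfDominoes b n t q) (site b′ t′ q′)
  halfDominoes-avoid-side zero b≢ = []
  halfDominoes-avoid-side (suc n) b≢ = along-avoids-side b≢ ∷
    All.++⁺ (rowDominoes-avoid-side _ (dbl n) b≢) (halfDominoes-avoid-side n b≢)

  -- Settling the rows of a half and the cut.

  Reads : Bool → Cover → ℕ → ℕ → Seq m → Set
  Reads b p t q [] = ⊤
  Reads b p t q (x ∷ v) = p (site b t q) ≡ bit x × Reads b p t (suc q) v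

  Reads-cong : ∀ {b p p′ t} q (v : Seq m) → (∀ q′ → q ≤ q′ → p′ (site b t q′) ≡ p (site b t q′)) →
    Reads b p t q v → Reads b p′ t q v
  Reads-cong q [] e r = tt
  Reads-cong q (x ∷ v) e (r , rs) = trans (e q ≤-refl) r ,
    Reads-cong (suc q) v (λ q′ q<q′ → e q′ (<⇒≤ q<q′)) rs

  -- The continuation hypothesis says that after the row has been settled the rest of the
  -- region sees only which cells w of the next row are already covered.
  row-step : ∀ b k t q cs ds p (v : Seq (suc k)) (F : Fn k) →
    (∀ q′ → Avoids ds (site b t q′)) →
    Reads b p t q v →
    (∀ q′ → q ≤ q′ → p (site b (suc t) q′) ≡ 0) →
    (∀ w p′ → Reads b p′ (suc t) q w →
      (∀ q′ → q′ < q → p′ (site b (suc t) q′) ≡ p (site b (suc t) q′)) →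
      (∀ t′ q′ → suc t < t′ → p′ (site b t′ q′) ≡ p (site b t′ q′)) →
      tilings cs ds p′ ≡ F w) →
    tilings (rowCells b t q (suc k) ++ cs) (rowDominoes b t q k ++ ds) p ≡ row false (capʳ (flip F)) v
  row-step b zero t q cs ds p (true ∷ []) F av (r , _) z h =
    trans (settle-1 (av q) r) (h [] p tt (λ _ _ → refl) (λ _ _ _ → refl))
  row-step b zero t q cs ds p (false ∷ []) F av (r , _) z h = settle-0 (av q) r
  row-step b (suc k) t q cs ds p (x ∷ v) F av (r , rs) z h = go x v r rs
    where
    open ≡-Reasoning
    cs′ = rowCells b t (suc q) (suc k) ++ cs
    ds′ = rowDominoes b t (suc q) k ++ ds
    s = site b t q
    A = along b t q
    O = outward b t q
    settled : Avoids ds′ s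
    settled = All.++⁺ (rowDominoes-avoid-position (suc q) k ≤-refl) (av q)
    one : ∀ {p′} → p′ s ≡ 1 → tilings (s ∷ cs′) ds′ p′ ≡ tilings cs′ ds′ p′
    one = settle-1 settled
    none : ∀ {p′} → p′ s ≡ 0 → tilings (s ∷ cs′) ds′ p′ ≡ 0
    none = settle-0 settled
    many : ∀ {p′} → 2 ≤ p′ s → tilings (s ∷ cs′) ds′ p′ ≡ 0
    many = overlap-0 ds′
    next : ∀ y p′ (v : Seq (suc k)) → Reads b p′ t (suc q) v →
      p′ (site b (suc t) q) ≡ bit y →
      (∀ q′ → q′ ≢ q → p′ (site b (suc t) q′) ≡ p (site b (suc t) q′)) →
      (∀ t′ q′ → suc t < t′ → p′ (site b t′ q′) ≡ p (site b t′ q′)) →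
      tilings cs′ ds′ p′ ≡ row false (capʳ (flip (F ∘ (y ∷_)))) v
    next y p′ v rs ey e e′ = row-step b k t (suc q) cs ds p′ v (F ∘ (y ∷_)) av rs
      (λ q′ q<q′ → trans (e q′ (>⇒≢ q<q′)) (z q′ (<⇒≤ q<q′)))
      (λ w p″ rs′ f f′ → h (y ∷ w) p″ (trans (f q ≤-refl) ey , rs′)
        (λ q′ q′<q → trans (f q′ (m<n⇒m<1+n q′<q)) (e q′ (<⇒≢ q′<q)))
        (λ t′ q′ t<t′ → trans (f′ t′ q′ t<t′) (e′ t′ q′ t<t′)))
    O-row : ∀ q′ → suc q ≤ q′ → (O ◂ p) (site b t q′) ≡ p (site b t q′)
    O-row q′ q<q′ = untouched O p (outward-avoids-position b t q (<⇒≢ q<q′))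
    O-out-≢ : ∀ q′ → q′ ≢ q → (O ◂ p) (site b (suc t) q′) ≡ p (site b (suc t) q′)
    O-out-≢ q′ q′≢q = untouched O p (outward-avoids-position b t q (q′≢q ∘ sym))
    O-far : ∀ t′ q′ → suc t < t′ → (O ◂ p) (site b t′ q′) ≡ p (site b t′ q′)
    O-far t′ q′ t<t′ = untouched O p (outward-avoids-depth b t q (<⇒≢ (<⇒≤ t<t′)) (<⇒≢ t<t′))
    A-row : ∀ q′ → suc (suc q) ≤ q′ → (A ◂ p) (site b t q′) ≡ p (site b t q′)
    A-row q′ q<q′ = untouched A p (along-avoids-position (<⇒≢ (<⇒≤ q<q′)) (<⇒≢ q<q′))
    A-out : ∀ t′ q′ → t < t′ → (A ◂ p) (site b t′ q′) ≡ p (site b t′ q′)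
    A-out t′ q′ t<t′ = untouched A p (along-avoids-depth (<⇒≢ t<t′))
    two : ∀ {a a′} → a ≡ 1 → a′ ≡ 1 → 2 ≤ a + a′
    two refl refl = ≤-refl
    A+O : ∀ {x} → p s ≡ x → (O ◂ A ◂ p) s ≡ 2 + x
    A+O e = cong₂ _+_ (outward-covers b t q) (cong₂ _+_ (along-covers b t q) e)
    go : ∀ x (v : Seq (suc k)) → p s ≡ bit x → Reads b p t (suc q) v →
      tilings (s ∷ cs′) (A ∷ O ∷ ds′) p ≡ row false (capʳ (flip F)) (x ∷ v)
    go true v r rs = begin
      tilings (s ∷ cs′) ds′ p + tilings (s ∷ cs′) ds′ (O ◂ p) +
        (tilings (s ∷ cs′) ds′ (A ◂ p) + tilings (s ∷ cs′) ds′ (O ◂ A ◂ p))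
        -- The cell is already covered, so only the choice of neither domino survives; the cell
        -- outward of it stays free.
        ≡⟨ cong₂ _+_ (cong₂ _+_ (one r) (many (two (outward-covers b t q) r)))
             (cong₂ _+_ (many (two (along-covers b t q) r)) (many (subst (2 ≤_) (sym (A+O r)) (s≤s (s≤s z≤n))))) ⟩
      tilings cs′ ds′ p + 0 + 0
        ≡⟨ trans (+-identityʳ _) (+-identityʳ _) ⟩
      tilings cs′ ds′ p
        ≡⟨ next false p v rs (z q ≤-refl) (λ _ _ → refl) (λ _ _ _ → refl) ⟩
      row false (capʳ (flip F)) (true ∷ v) ∎
    go false (y ∷ v) r rs = begin
      tilings (s ∷ cs′) ds′ p + tilings (s ∷ cs′) ds′ (O ◂ p) +
        (tilings (s ∷ cs′) ds′ (A ◂ p) + tilings (s ∷ cs′) ds′ (O ◂ A ◂ p))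
        -- The cell is free, so exactly one of `O` and `A` must be used.
        ≡⟨ cong₂ _+_ (cong₂ _+_ (none r) (one (cong₂ _+_ (outward-covers b t q) r)))
             (cong₂ _+_ (one (cong₂ _+_ (along-covers b t q) r)) (many (≤-reflexive (sym (A+O r))))) ⟩
      tilings cs′ ds′ (O ◂ p) + (tilings cs′ ds′ (A ◂ p) + 0)
        ≡⟨ cong (tilings cs′ ds′ (O ◂ p) +_) (+-identityʳ _) ⟩
      tilings cs′ ds′ (O ◂ p) + tilings cs′ ds′ (A ◂ p)
        ≡⟨ cong (_+ tilings cs′ ds′ (A ◂ p)) (next true (O ◂ p) (y ∷ v)
             (Reads-cong {p = p} {O ◂ p} (suc q) (y ∷ v) O-row rs) (cong₂ _+_ (outward-covers-next b t q) (z q ≤-refl)) O-out-≢ O-far) ⟩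
      row false (capʳ (flip (F ∘ (true ∷_)))) (y ∷ v) + tilings cs′ ds′ (A ◂ p)
        -- If the neighbour is free, `A` yields the 11 term of `hop` at 00; if it is covered, `A`
        -- overlaps, and `hop` fixes 01.
        ≡⟨ finish y rs ⟩
      row false (capʳ (flip F)) (false ∷ y ∷ v) ∎
      where
      finish : ∀ y → Reads b p t (suc q) (y ∷ v) →
        row false (capʳ (flip (F ∘ (true ∷_)))) (y ∷ v) + tilings cs′ ds′ (A ◂ p) ≡
        row false (capʳ (flip F)) (false ∷ y ∷ v)
      finish false (r′ , rs) = cong (row false (capʳ (flip (F ∘ (true ∷_)))) (false ∷ v) +_)
        (next false (A ◂ p) (true ∷ v)
          (cong₂ _+_ (along-covers-next b t q) r′ , Reads-cong (suc (suc q)) v A-row rs)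
          (trans (A-out (suc t) q ≤-refl) (z q ≤-refl))
          (λ q′ _ → A-out (suc t) q′ ≤-refl)
          (λ t′ q′ t<t′ → A-out t′ q′ (<-trans ≤-refl t<t′)))
      finish true (r′ , rs) = trans
        (cong (row false (capʳ (flip (F ∘ (true ∷_)))) (true ∷ v) +_) (overlap-0 ds′ (two (along-covers-next b t q) r′)))
        (+-identityʳ _)

  -- The first cell of a row can only use its `along` domino, which is the condition of `cap` on the
  -- first entry; the rest of the row is `row-step`.
  half-tilings : ∀ b n t q p (v : Seq (dbl n)) → Reads b p t q v →
    (∀ t′ q′ → t < t′ → p (site b t′ q′) ≡ 0) →
    tilings (halfCells b n t q) (halfDominoes b n t q) p ≡ half n v
  half-tilings b zero t q p [] _ _ = refl
  half-tilings b (suc n) t q p (x ∷ y ∷ v) (r , r′ , rs) z = go x y r r′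
    where
    open ≡-Reasoning
    cs = halfCells b n (suc t) (suc q)
    ds = halfDominoes b n (suc t) (suc q)
    cs′ = rowCells b t (suc q) (suc (dbl n)) ++ cs
    ds′ = rowDominoes b t (suc q) (dbl n) ++ ds
    s = site b t q
    A = along b t q
    A-row : ∀ q′ → suc (suc q) ≤ q′ → (A ◂ p) (site b t q′) ≡ p (site b t q′)
    A-row q′ q<q′ = untouched A p (along-avoids-position (<⇒≢ (<⇒≤ q<q′)) (<⇒≢ q<q′))
    A-out : ∀ t′ q′ → t < t′ → (A ◂ p) (site b t′ q′) ≡ p (site b t′ q′)
    A-out t′ q′ t<t′ = untouched A p (along-avoids-depth (<⇒≢ t<t′))
    two : ∀ {a a′} → a ≡ 1 → a′ ≡ 1 → 2 ≤ a + a′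
    two refl refl = ≤-refl
    settled : Avoids ds′ s
    settled = All.++⁺ (rowDominoes-avoid-position (suc q) (dbl n) ≤-refl) (halfDominoes-avoid-depth n ≤-refl)
    step : ∀ p′ (v : Seq (suc (dbl n))) → Reads b p′ t (suc q) v →
      (∀ t′ q′ → t < t′ → p′ (site b t′ q′) ≡ 0) →
      tilings cs′ ds′ p′ ≡ row false (capʳ (flip (half n))) v
    step p′ v rs z = row-step b (dbl n) t (suc q) cs ds p′ v (half n)
      (λ q′ → halfDominoes-avoid-depth n ≤-refl) rs (λ q′ _ → z (suc t) q′ ≤-refl)
      (λ w p″ rs′ _ e → half-tilings b n (suc t) (suc q) p″ w rs′
        (λ t′ q′ t<t′ → trans (e t′ q′ t<t′) (z t′ q′ (<⇒≤ t<t′))))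
    go : ∀ x y → p s ≡ bit x → p (site b t (suc q)) ≡ bit y →
      tilings (s ∷ cs′) ds′ p + tilings (s ∷ cs′) ds′ (A ◂ p) ≡ half (suc n) (x ∷ y ∷ v)
    go true y r r′ = trans
      (cong₂ _+_ (trans (settle-1 settled r) (step p (y ∷ v) (r′ , rs) z)) (overlap-0 ds′ (two (along-covers b t q) r)))
      (+-identityʳ _)
    go false true r r′ = trans
      (cong₂ _+_ (settle-0 settled r) (trans (settle-1 settled (cong₂ _+_ (along-covers b t q) r)) (overlap-0 ds′ (two (along-covers-next b t q) r′))))
      (sym (null (row-linear false) (true ∷ v)))
    go false false r r′ = cong₂ _+_
      (trans (settle-0 settled r) (sym (null (row-linear false) (false ∷ v))))
      (trans (settle-1 settled (cong₂ _+_ (along-covers b t q) r))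
        (step (A ◂ p) (true ∷ v) (cong₂ _+_ (along-covers-next b t q) r′ , Reads-cong (suc (suc q)) v A-row rs)
          (λ t′ q′ t<t′ → trans (A-out t′ q′ t<t′) (z t′ q′ t<t′))))

  -- Each domino across the cut covers one cell on either side at the same position, so both halves
  -- read the same sequence w.
  cut-step : ∀ m q cs ds p (F : Fn m) →
    (∀ b q′ → q ≤ q′ → p (site b 0 q′) ≡ 0) →
    (∀ w p′ → (∀ b → Reads b p′ 0 q w) →
      (∀ b q′ → q′ < q → p′ (site b 0 q′) ≡ p (site b 0 q′)) →
      (∀ b t q′ → 0 < t → p′ (site b t q′) ≡ p (site b t q′)) →
      tilings cs ds p′ ≡ F w) →
    tilings cs (cutDominoes q m ++ ds) p ≡ total F
  cut-step zero q cs ds p F z h = h [] p (λ _ → tt) (λ _ _ _ → refl) (λ _ _ _ _ → refl)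
  cut-step (suc m) q cs ds p F z h = cong₂ _+_
    (next false p (λ b → z b q ≤-refl) (λ _ _ _ → refl) (λ _ _ _ _ → refl))
    (next true (across q ◂ p) (λ b → cong₂ _+_ (across-covers b q) (z b q ≤-refl))
      (λ b q′ q′≢q → untouched (across q) p (cong₂ _+_ (hit-position (q′≢q ∘ sym)) (hit-position (q′≢q ∘ sym))))
      (λ b t q′ 0<t → untouched (across q) p (cong₂ _+_ (hit-depth (<⇒≢ 0<t)) (hit-depth (<⇒≢ 0<t)))))
    where
    next : ∀ y p′ → (∀ b → p′ (site b 0 q) ≡ bit y) →
      (∀ b q′ → q′ ≢ q → p′ (site b 0 q′) ≡ p (site b 0 q′)) →
      (∀ b t q′ → 0 < t → p′ (site b t q′) ≡ p (site b t q′)) →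
      tilings cs (cutDominoes (suc q) m ++ ds) p′ ≡ total (F ∘ (y ∷_))
    next y p′ ey e e′ = cut-step m (suc q) cs ds p′ (F ∘ (y ∷_))
      (λ b q′ q<q′ → trans (e b q′ (>⇒≢ q<q′)) (z b q′ (<⇒≤ q<q′)))
      (λ w p″ rs f f′ → h (y ∷ w) p″ (λ b → trans (f b q ≤-refl) (ey b) , rs b)
        (λ b q′ q′<q → trans (f b q′ (m<n⇒m<1+n q′<q)) (e b q′ (<⇒≢ q′<q)))
        (λ b t q′ 0<t → trans (f′ b t q′ 0<t) (e′ b t q′ 0<t)))

  -- Membership and distinctness in the lists arranged by rows.

  rowCells-All : ∀ {P : Cell → Set} {b t} q k →
    (∀ q′ → q ≤ q′ → q′ < q + k → P (site b t q′)) → All P (rowCells b t q k)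
  rowCells-All q zero h = []
  rowCells-All q (suc k) h = h q ≤-refl (m<m+n q z<s) ∷
    rowCells-All (suc q) k (λ q′ q<q′ lt → h q′ (<⇒≤ q<q′) (subst (q′ <_) (sym (+-suc q k)) lt))

  rowCells-∈ : ∀ {b t q′} q k → q ≤ q′ → q′ < q + k → site b t q′ ∈ rowCells b t q k
  rowCells-∈ q zero q≤q′ lt = contradiction q≤q′ (<-empty q lt)
  rowCells-∈ q (suc k) q≤q′ lt with m≤n⇒m<n∨m≡n q≤q′
  ... | inj₂ refl = here refl
  ... | inj₁ q<q′ = there (rowCells-∈ (suc q) k q<q′ (<-shift q k lt))

  rowCells-unique : ∀ {b t} q k {cs} → Unique cs → (∀ q′ → All (site b t q′ ≢_) cs) →
    Unique (rowCells b t q k ++ cs)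
  rowCells-unique q zero u f = u
  rowCells-unique q (suc k) u f =
    All.++⁺ (rowCells-All (suc q) k (λ q′ q<q′ _ e → <⇒≢ q<q′ (proj₂ (proj₂ (site-injective e))))) (f q)
      ∷ rowCells-unique (suc q) k u f

  module _ {n : ℕ} where

    -- Row t starts at position t, so one number serves as depth and as position, and m counts the
    -- rows still to come.
    halfCells-All : ∀ {P : Cell → Set} {b} m t → m + t ≡ n →
      (∀ t′ q′ → t ≤ t′ → Inside n t′ q′ → P (site b t′ q′)) → All P (halfCells b m t t)
    halfCells-All zero t e h = []
    halfCells-All (suc m) t refl h = All.++⁺
      (rowCells-All t (dbl (suc m)) (λ q′ t≤q′ lt → h t q′ ≤-refl
        (t≤q′ , subst (q′ + t <_) (sym (dbl-+ (suc m) t)) (+-monoˡ-< t lt))))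
      (halfCells-All m (suc t) (+-suc m t) (λ t′ q′ t<t′ → h t′ q′ (<⇒≤ t<t′)))

    halfCells-∈ : ∀ {b t′ q′} m t → m + t ≡ n → t ≤ t′ → Inside n t′ q′ → site b t′ q′ ∈ halfCells b m t t
    halfCells-∈ zero t refl t≤t′ i = contradiction i (outside t≤t′)
    halfCells-∈ {b} {t′} {q′} (suc m) t refl t≤t′ i@(t′≤q′ , lt) with m≤n⇒m<n∨m≡n t≤t′
    ... | inj₂ refl = ∈-++⁺ˡ (rowCells-∈ t (dbl (suc m)) t′≤q′
            (+-cancelʳ-< t q′ _ (subst (q′ + t <_) (dbl-+ (suc m) t) lt)))
    ... | inj₁ t<t′ = ∈-++⁺ʳ (rowCells b t t (dbl (suc m))) (halfCells-∈ m (suc t) (+-suc m t) t<t′ i)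

    halfDominoes-All : ∀ {P : Domino → Set} {b} m t → m + t ≡ n →
      (∀ t′ q′ → Inside n t′ q′ → Inside n t′ (suc q′) → P (along b t′ q′)) →
      (∀ t′ q′ → Inside n t′ q′ → Inside n (suc t′) q′ → P (outward b t′ q′)) →
      All P (halfDominoes b m t t)
    halfDominoes-All zero t e h h′ = []
    halfDominoes-All {P} {b} (suc m) t refl h h′ =
      h t t (≤-refl , <⇒≤ (bound (m≤m+n (suc t) (dbl m)))) (n≤1+n t , bound (m≤m+n (suc t) (dbl m))) ∷
      All.++⁺ (rows (suc t) (dbl m) ≤-refl ≤-refl) (halfDominoes-All m (suc t) (+-suc m t) h h′)
      where
      bound : ∀ {q} → q < suc t + dbl m → suc q + t < dbl (suc m + t)
      bound {q} lt = subst (suc q + t <_) (sym (dbl-+ (suc m) t))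
        (+-monoˡ-< t (subst (suc q <_) (sym (+-suc t (suc (dbl m))))
          (s<s (subst (q <_) (sym (+-suc t (dbl m))) lt))))
      rows : ∀ q k → suc t ≤ q → q + k ≤ suc t + dbl m → All P (rowDominoes b t q k)
      rows q zero t<q le = []
      rows q (suc k) t<q le =
        h t q (<⇒≤ t<q , <⇒≤ lt) (m≤n⇒m≤1+n (<⇒≤ t<q) , lt) ∷
        h′ t q (<⇒≤ t<q , <⇒≤ lt) (t<q , subst (_< dbl (suc m + t)) (sym (+-suc q t)) lt) ∷
        rows (suc q) k (m≤n⇒m≤1+n t<q) (subst (_≤ suc t + dbl m) (+-suc q k) le)
        where
        lt = bound (≤-trans (subst (q <_) (sym (+-suc q k)) (s≤s (m≤m+n q k))) le)

    along-∈ : ∀ {b t′ q′} m t → m + t ≡ n → t ≤ t′ → Inside n t′ q′ → Inside n t′ (suc q′) →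
      along b t′ q′ ∈ halfDominoes b m t t
    along-∈ zero t refl t≤t′ i _ = contradiction i (outside t≤t′)
    along-∈ {b} {t′} {q′} (suc m) t refl t≤t′ i@(t′≤q′ , _) i′@(_ , lt) with m≤n⇒m<n∨m≡n t≤t′
    ... | inj₁ t<t′ = there (∈-++⁺ʳ (rowDominoes b t (suc t) (dbl m)) (along-∈ m (suc t) (+-suc m t) t<t′ i i′))
    ... | inj₂ refl with m≤n⇒m<n∨m≡n t′≤q′
    ...   | inj₂ refl = here refl
    ...   | inj₁ t<q′ = there (∈-++⁺ˡ (go (suc t) (dbl m) t<q′ (unbound m lt)))
      where
      go : ∀ q k → q ≤ q′ → q′ < q + k → along b t q′ ∈ rowDominoes b t q k
      go q zero q≤q′ lt = contradiction q≤q′ (<-empty q lt)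
      go q (suc k) q≤q′ lt with m≤n⇒m<n∨m≡n q≤q′
      ... | inj₂ refl = here refl
      ... | inj₁ q<q′ = there (there (go (suc q) k q<q′ (<-shift q k lt)))

    outward-∈ : ∀ {b t′ q′} m t → m + t ≡ n → t ≤ t′ → Inside n t′ q′ → Inside n (suc t′) q′ →
      outward b t′ q′ ∈ halfDominoes b m t t
    outward-∈ zero t refl t≤t′ i _ = contradiction i (outside t≤t′)
    outward-∈ {b} {t′} {q′} (suc m) t refl t≤t′ i i′@(t<q′ , lt) with m≤n⇒m<n∨m≡n t≤t′
    ... | inj₁ t<t′ = there (∈-++⁺ʳ (rowDominoes b t (suc t) (dbl m)) (outward-∈ m (suc t) (+-suc m t) t<t′ i i′))
    ... | inj₂ refl = there (∈-++⁺ˡ (go (suc t) (dbl m) t<q′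
            (unbound m (subst (_< dbl (suc m + t)) (+-suc q′ t) lt))))
      where
      go : ∀ q k → q ≤ q′ → q′ < q + k → outward b t q′ ∈ rowDominoes b t q k
      go q zero q≤q′ lt = contradiction q≤q′ (<-empty q lt)
      go q (suc k) q≤q′ lt with m≤n⇒m<n∨m≡n q≤q′
      ... | inj₂ refl = there (here refl)
      ... | inj₁ q<q′ = there (there (go (suc q) k q<q′ (<-shift q k lt)))

  halfCells-unique : ∀ {b} m t {cs} → Unique cs → (∀ t′ q′ → All (site b t′ q′ ≢_) cs) →
    Unique (halfCells b m t t ++ cs)
  halfCells-unique zero t u f = u
  halfCells-unique {b} (suc m) t {cs} u f =
    subst Unique (sym (++-assoc (rowCells b t t (dbl (suc m))) _ cs))
      (rowCells-unique t (dbl (suc m)) (halfCells-unique m (suc t) u f)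
        (λ q → All.++⁺ (halfCells-All m (suc t) refl
            (λ t′ q′ t<t′ _ e → <⇒≢ t<t′ (proj₁ (proj₂ (site-injective e))))) (f t q)))

  -- A domino is told apart from others by a cell that it covers and they do not.
  fresh : ∀ {d ds} c → cover d c ≡ 1 → Avoids ds c → All (d ≢_) ds
  fresh c e = All.map (λ { e′ refl → contradiction (trans (sym e) e′) λ () })

  rowDominoes-unique : ∀ {b t} q k {ds} → Unique ds → (∀ q′ → Avoids ds (site b t q′)) →
    Unique (rowDominoes b t q k ++ ds)
  rowDominoes-unique q zero u av = u
  rowDominoes-unique {b} {t} q (suc k) {ds} u av =
    -- The `along` and `outward` dominoes of one position share their first site, so they are
    -- separated by the next cell of the row.
    (All.head (fresh (site b t (suc q)) (along-covers-next b t q)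
        (outward-avoids-position b t q (1+n≢n ∘ sym) ∷ [])) ∷ fresh s (along-covers b t q) settled) ∷
    fresh s (outward-covers b t q) settled ∷
    rowDominoes-unique (suc q) k u av
    where
    s = site b t q
    settled : Avoids (rowDominoes b t (suc q) k ++ ds) s
    settled = All.++⁺ (rowDominoes-avoid-position (suc q) k ≤-refl) (av q)

  halfDominoes-unique : ∀ {b} m t q {ds} → Unique ds → (∀ t′ q′ → Avoids ds (site b t′ q′)) →
    Unique (halfDominoes b m t q ++ ds)
  halfDominoes-unique zero t q u av = u
  halfDominoes-unique {b} (suc m) t q {ds} u av =
    subst (λ ds′ → Unique (along b t q ∷ ds′)) (sym (++-assoc (rowDominoes b t (suc q) (dbl m)) _ ds))
      (fresh (site b t q) (along-covers b t q)
          (All.++⁺ (rowDominoes-avoid-position (suc q) (dbl m) ≤-refl) (rest q))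
        ∷ rowDominoes-unique (suc q) (dbl m) (halfDominoes-unique m (suc t) (suc q) u av) rest)
    where
    rest : ∀ q′ → Avoids (halfDominoes b m (suc t) (suc q) ++ ds) (site b t q′)
    rest q′ = All.++⁺ (halfDominoes-avoid-depth m ≤-refl) (av t q′)

  cutDominoes-avoid : ∀ {b t q′} q k → q′ < q → Avoids (cutDominoes q k) (site b t q′)
  cutDominoes-avoid q zero q′<q = []
  cutDominoes-avoid q (suc k) q′<q =
    cong₂ _+_ (hit-position (>⇒≢ q′<q)) (hit-position (>⇒≢ q′<q)) ∷
    cutDominoes-avoid (suc q) k (m<n⇒m<1+n q′<q)

  cutDominoes-unique : ∀ q k {ds ds′} → Unique (ds ++ ds′) →
    (∀ q′ → Avoids ds (site false 0 q′)) → (∀ q′ → Avoids ds′ (site true 0 q′)) →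
    Unique (cutDominoes q k ++ (ds ++ ds′))
  cutDominoes-unique q zero u av av′ = u
  cutDominoes-unique q (suc k) u av av′ =
    All.++⁺ (fresh (site true 0 q) (across-covers true q) (cutDominoes-avoid (suc q) k ≤-refl))
      (All.++⁺ (fresh (site false 0 q) (across-covers false q) (av q))
        (fresh (site true 0 q) (across-covers true q) (av′ q)))
    ∷ cutDominoes-unique (suc q) k u av av′

  cutDominoes-All : ∀ {P : Domino → Set} q k →
    (∀ q′ → q ≤ q′ → q′ < q + k → P (across q′)) → All P (cutDominoes q k)
  cutDominoes-All q zero h = []
  cutDominoes-All q (suc k) h = h q ≤-refl (m<m+n q z<s) ∷
    cutDominoes-All (suc q) k (λ q′ q<q′ lt → h q′ (<⇒≤ q<q′) (subst (q′ <_) (sym (+-suc q k)) lt))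

  across-∈ : ∀ {q′} q k → q ≤ q′ → q′ < q + k → across q′ ∈ cutDominoes q k
  across-∈ q zero q≤q′ lt = contradiction q≤q′ (<-empty q lt)
  across-∈ q (suc k) q≤q′ lt with m≤n⇒m<n∨m≡n q≤q′
  ... | inj₂ refl = here refl
  ... | inj₁ q<q′ = there (across-∈ (suc q) k q<q′ (<-shift q k lt))

  diamondCells : ℕ → List Cell
  diamondCells n = halfCells true n 0 0 ++ halfCells false n 0 0

  diamondDominoes : ℕ → List Domino
  diamondDominoes n = cutDominoes 0 (dbl n) ++ (halfDominoes true n 0 0 ++ halfDominoes false n 0 0)

  diamond-tilings : ∀ n →
    tilings (diamondCells n) (diamondDominoes n) (λ _ → 0) ≡ total (half n ⊙ half n)
  diamond-tilings n = cut-step (dbl n) 0 (diamondCells n) _ (λ _ → 0) (half n ⊙ half n) (λ _ _ _ → refl)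
    (λ w p rs _ z → trans
      (tilings-++ (halfCells true n 0 0) _ (halfDominoes true n 0 0) _ p
        (halfCells-All n 0 (+-identityʳ n) (λ t q _ _ → halfDominoes-avoid-side n (λ ())))
        (halfCells-All n 0 (+-identityʳ n) (λ t q _ _ → halfDominoes-avoid-side n (λ ()))))
      (cong₂ _*_ (half-tilings true n 0 0 p w (rs true) (z true))
        (half-tilings false n 0 0 p w (rs false) (z false))))

  diamondCells-unique : ∀ n → Unique (diamondCells n)
  diamondCells-unique n = halfCells-unique n 0
    (subst Unique (++-identityʳ _) (halfCells-unique n 0 [] (λ _ _ → [])))
    (λ t q → halfCells-All n 0 refl (λ t′ q′ _ _ e → contradiction (proj₁ (site-injective e)) λ ()))

  diamondDominoes-unique : ∀ n → Unique (diamondDominoes n)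
  diamondDominoes-unique n = cutDominoes-unique 0 (dbl n)
    (halfDominoes-unique n 0 0
      (subst Unique (++-identityʳ _) (halfDominoes-unique n 0 0 [] (λ _ _ → [])))
      (λ _ _ → halfDominoes-avoid-side n (λ ())))
    (λ _ → halfDominoes-avoid-side n (λ ()))
    (λ _ → halfDominoes-avoid-side n (λ ()))

-- The diamond in coordinates

concatMap-if : ∀ {A B : Set} (P : A → Bool) (g : A → B) {f : A → List B} →
  (∀ x → f x ≡ (if P x then g x ∷ [] else [])) →
  ∀ xs → concatMap f xs ≡ map g (filter (λ x → P x ≟B true) xs)
concatMap-if P g e [] = refl
concatMap-if P g {f} e (x ∷ xs) with P x | e x
... | true | e′ = cong₂ _++_ e′ (concatMap-if P g e xs)
... | false | e′ = cong₂ _++_ e′ (concatMap-if P g e xs)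

concatMap-map : ∀ {A B : Set} (xs : List A) (ys : List B) →
  concatMap (λ x → map (x ,_) ys) xs ≡ cartesianProduct xs ys
concatMap-map [] ys = refl
concatMap-map (x ∷ xs) ys = cong (map (x ,_) ys ++_) (concatMap-map xs ys)

⊖-injective : ∀ n {q q′} → q ⊖ n ≡ q′ ⊖ n → q ≡ q′
⊖-injective n {q} {q′} e = ℤ.+-injective (∙-cancelʳ (ℤ.- (ℤ.+ n)) (ℤ.+ q) (ℤ.+ q′)
  (trans (ℤ.m-n≡m⊖n q n) (trans e (sym (ℤ.m-n≡m⊖n q′ n)))))

depth : Bool → ℕ → ℤ
depth true t = ℤ.+ t
depth false t = -[1+ t ]

-- The cut is the line x = 0, with the columns t and -1-t at distance t from it; subtracting n makes
-- the positions of row 0 start at height -n.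
siteOf : ℕ → Bool → ℕ → ℕ → Cell
siteOf n b t q = depth b t , q ⊖ n

siteOf-injective : ∀ n {b t q b′ t′ q′} → siteOf n b t q ≡ siteOf n b′ t′ q′ → b ≡ b′ × t ≡ t′ × q ≡ q′
siteOf-injective n {b} {t} {q} {b′} {t′} e with depth-injective b b′ (cong proj₁ e)
  where
  depth-injective : ∀ b b′ {t t′} → depth b t ≡ depth b′ t′ → b ≡ b′ × t ≡ t′
  depth-injective true true refl = refl , refl
  depth-injective false false refl = refl , refl
... | e₁ , e₂ = e₁ , e₂ , ⊖-injective n (cong proj₂ e)

⊖-suc : ∀ q n → q ⊖ n ℤ.+ ℤ.+ 1 ≡ suc q ⊖ n
⊖-suc q n = trans (ℤ.+-comm (q ⊖ n) (ℤ.+ 1)) (ℤ.distribʳ-⊖-+-pos 1 q n)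

depth-true-suc : ∀ t → ℤ.+ t ℤ.+ ℤ.+ 1 ≡ ℤ.+ suc t
depth-true-suc t = cong ℤ.+_ (+-comm t 1)

dbl-n : ∀ n → dbl n ≡ n + n
dbl-n n = trans (dbl-+ 0 n) (cong (_+ n) (+-identityʳ n))

∣⊖∣-≥ : ∀ {q n} → n ≤ q → ∣ q ⊖ n ∣ ≡ q ∸ n
∣⊖∣-≥ n≤q = cong ∣_∣ (ℤ.⊖-≥ n≤q)

-- Of the four corners of a cell, the two farther from the cut decide whether it lies in the diamond.
corners⇒inside : ∀ n t q → t + ∣ q ⊖ n ∣ ≤ n → t + ∣ suc q ⊖ n ∣ ≤ n → Inside n t q
corners⇒inside n t q h h′ with <-≤-connex q n
... | inj₁ q<n = t≤q , <-≤-trans (+-mono-<-≤ q<n (≤-trans t≤q (<⇒≤ q<n))) (≤-reflexive (sym (dbl-n n)))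
  where
  t≤q : t ≤ q
  t≤q = +-cancelʳ-≤ (n ∸ q) t q (≤-trans (subst (λ d → t + d ≤ n) (ℤ.∣⊖∣-≤ (<⇒≤ q<n)) h)
    (≤-reflexive (sym (m+[n∸m]≡n (<⇒≤ q<n)))))
... | inj₂ n≤q = ≤-trans (m+n≤o⇒m≤o t h) n≤q , (begin
    suc q + t              ≡⟨ cong (_+ t) (sym (m∸n+n≡m n≤1+q)) ⟩
    suc q ∸ n + n + t      ≡⟨ shuffle (suc q ∸ n) n t ⟩
    t + (suc q ∸ n) + n    ≤⟨ +-monoˡ-≤ n (subst (λ d → t + d ≤ n) (∣⊖∣-≥ n≤1+q) h′) ⟩
    n + n                  ≡⟨ sym (dbl-n n) ⟩
    dbl n                  ∎)
  where
  open ≤-Reasoning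
  n≤1+q = m≤n⇒m≤1+n n≤q
  shuffle : ∀ a b c → a + b + c ≡ c + a + b
  shuffle = solve-∀

inside⇒corners : ∀ n t q → Inside n t q → t + ∣ q ⊖ n ∣ ≤ n × t + ∣ suc q ⊖ n ∣ ≤ n
inside⇒corners n t q (t≤q , lt) with <-≤-connex q n
... | inj₁ q<n = near , ≤-trans (+-monoʳ-≤ t (begin
    ∣ suc q ⊖ n ∣  ≡⟨ ℤ.∣⊖∣-≤ q<n ⟩
    n ∸ suc q      ≤⟨ ∸-monoʳ-≤ n (n≤1+n q) ⟩
    n ∸ q          ≡⟨ sym (ℤ.∣⊖∣-≤ (<⇒≤ q<n)) ⟩
    ∣ q ⊖ n ∣      ∎)) near
  where
  open ≤-Reasoning
  near : t + ∣ q ⊖ n ∣ ≤ n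
  near = begin
    t + ∣ q ⊖ n ∣  ≡⟨ cong (t +_) (ℤ.∣⊖∣-≤ (<⇒≤ q<n)) ⟩
    t + (n ∸ q)    ≤⟨ +-monoˡ-≤ (n ∸ q) t≤q ⟩
    q + (n ∸ q)    ≡⟨ m+[n∸m]≡n (<⇒≤ q<n) ⟩
    n              ∎
... | inj₂ n≤q = ≤-trans (+-monoʳ-≤ t (begin
    ∣ q ⊖ n ∣      ≡⟨ ∣⊖∣-≥ n≤q ⟩
    q ∸ n          ≤⟨ ∸-monoˡ-≤ n (n≤1+n q) ⟩
    suc q ∸ n      ≡⟨ sym (∣⊖∣-≥ n≤1+q) ⟩
    ∣ suc q ⊖ n ∣  ∎)) far , far
  where
  open ≤-Reasoning
  n≤1+q = m≤n⇒m≤1+n n≤q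
  shuffle : ∀ a b c → c + a + b ≡ a + b + c
  shuffle = solve-∀
  far : t + ∣ suc q ⊖ n ∣ ≤ n
  far = +-cancelʳ-≤ n _ n (begin
    t + ∣ suc q ⊖ n ∣ + n  ≡⟨ cong (λ d → t + d + n) (∣⊖∣-≥ n≤1+q) ⟩
    t + (suc q ∸ n) + n    ≡⟨ shuffle (suc q ∸ n) n t ⟩
    suc q ∸ n + n + t      ≡⟨ cong (_+ t) (m∸n+n≡m n≤1+q) ⟩
    suc q + t              ≤⟨ lt ⟩
    dbl n                  ≡⟨ dbl-n n ⟩
    n + n                  ∎)

Corner : ℕ → ℤ → ℤ → Set
Corner n x y = ∣ x ∣ + ∣ y ∣ ≤ suc n

inAD⇒corners : ∀ n i j → inAD n (i , j) ≡ true →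
  Corner n i j × Corner n (i ℤ.+ ℤ.+ 1) j × Corner n i (j ℤ.+ ℤ.+ 1) × Corner n (i ℤ.+ ℤ.+ 1) (j ℤ.+ ℤ.+ 1)
inAD⇒corners n i j e =
  let a , e₁ = to T-∧ (from T-≡ e)
      b , e₂ = to T-∧ e₁
      c , d = to T-∧ e₂
  in ≤ᵇ⇒≤ _ _ a , ≤ᵇ⇒≤ _ _ b , ≤ᵇ⇒≤ _ _ c , ≤ᵇ⇒≤ _ _ d
  where open Equivalence

corners⇒inAD : ∀ n i j →
  Corner n i j → Corner n (i ℤ.+ ℤ.+ 1) j → Corner n i (j ℤ.+ ℤ.+ 1) → Corner n (i ℤ.+ ℤ.+ 1) (j ℤ.+ ℤ.+ 1) →
  inAD n (i , j) ≡ true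
corners⇒inAD n i j a b c d =
  to T-≡ (from T-∧ (≤⇒≤ᵇ a , from T-∧ (≤⇒≤ᵇ b , from T-∧ (≤⇒≤ᵇ c , ≤⇒≤ᵇ d))))
  where open Equivalence

∣1⊖suc∣ : ∀ t → ∣ 1 ⊖ suc t ∣ ≡ t
∣1⊖suc∣ t = ℤ.∣⊖∣-≤ (s≤s z≤n)

inAD⇒inside : ∀ n b t q → inAD n (siteOf n b t q) ≡ true → Inside n t q
inAD⇒inside n true t q e with inAD⇒corners n (ℤ.+ t) (q ⊖ n) e
... | _ , h , _ , h′ = corners⇒inside n t q
  (s≤s⁻¹ (subst (λ a → a + ∣ q ⊖ n ∣ ≤ suc n) (+-comm t 1) h))
  (s≤s⁻¹ (subst₂ (λ a j → a + ∣ j ∣ ≤ suc n) (+-comm t 1) (⊖-suc q n) h′))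
inAD⇒inside n false t q e with inAD⇒corners n -[1+ t ] (q ⊖ n) e
... | h , _ , h′ , _ = corners⇒inside n t q (s≤s⁻¹ h)
  (s≤s⁻¹ (subst (λ j → suc t + ∣ j ∣ ≤ suc n) (⊖-suc q n) h′))

inside⇒inAD : ∀ n b t q → Inside n t q → inAD n (siteOf n b t q) ≡ true
inside⇒inAD n b t q i = corners⇒inAD n (depth b t) (q ⊖ n)
  (corner (depth-≤ b) h) (corner (depth-suc-≤ b) h)
  (subst (Corner n (depth b t)) (sym (⊖-suc q n)) (corner (depth-≤ b) h′))
  (subst (Corner n (depth b t ℤ.+ ℤ.+ 1)) (sym (⊖-suc q n)) (corner (depth-suc-≤ b) h′))
  where
  h = proj₁ (inside⇒corners n t q i)
  h′ = proj₂ (inside⇒corners n t q i)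
  corner : ∀ {a d} → a ≤ suc t → t + d ≤ n → a + d ≤ suc n
  corner {d = d} a≤ d≤ = ≤-trans (+-monoˡ-≤ d a≤) (s≤s d≤)
  depth-≤ : ∀ b → ∣ depth b t ∣ ≤ suc t
  depth-≤ true = n≤1+n t
  depth-≤ false = ≤-refl
  depth-suc-≤ : ∀ b → ∣ depth b t ℤ.+ ℤ.+ 1 ∣ ≤ suc t
  depth-suc-≤ true = ≤-reflexive (+-comm t 1)
  depth-suc-≤ false = ≤-trans (≤-reflexive (∣1⊖suc∣ t)) (n≤1+n t)

data IsSite (n : ℕ) : Cell → Set where
  isSite : ∀ b t q → Inside n t q → IsSite n (siteOf n b t q)

asSite : ∀ n c → inAD n c ≡ true → IsSite n c
asSite n (i , j) e with asDepth i
  where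
  asDepth : ∀ i → ∃[ b ] ∃[ t ] i ≡ depth b t
  asDepth (ℤ.+ t) = true , t , refl
  asDepth -[1+ t ] = false , t , refl
... | b , t , refl = go j e
  where
  height : ∀ b j → inAD n (depth b t , j) ≡ true → t + ∣ j ∣ ≤ n
  height true j e = s≤s⁻¹ (subst (λ a → a + ∣ j ∣ ≤ suc n) (+-comm t 1) (proj₁ (proj₂ (inAD⇒corners n (ℤ.+ t) j e))))
  height false j e = s≤s⁻¹ (proj₁ (inAD⇒corners n -[1+ t ] j e))
  at : ∀ q {j} → q ⊖ n ≡ j → inAD n (depth b t , j) ≡ true → IsSite n (depth b t , j)
  at q refl e = isSite b t q (inAD⇒inside n b t q e)
  go : ∀ j → inAD n (depth b t , j) ≡ true → IsSite n (depth b t , j)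
  go (ℤ.+ m) e = at (m + n) (trans (ℤ.⊖-≥ (m≤n+m n m)) (cong ℤ.+_ (m+n∸n≡m m n))) e
  -- The bound from `height` gives m + 1 ≤ n, so the subtraction is not truncated.
  go -[1+ m ] e = at (n ∸ suc m) (trans (ℤ.⊖-≤ (m∸n≤m n (suc m)))
    (cong (λ d → ℤ.- ℤ.+ d) (m∸[m∸n]≡n (m+n≤o⇒n≤o t (height b -[1+ m ] e))))) e

range-unique : ∀ n → Unique (range n)
range-unique n = Unique.map⁺
  (λ {x} {y} e → ℤ.+-injective (∙-cancelʳ (ℤ.- (ℤ.+ suc n)) (ℤ.+ x) (ℤ.+ y) e))
  (Unique.upTo⁺ (dbl (suc n)))

∈-range : ∀ n s {i} → s < dbl (suc n) → s ⊖ suc n ≡ i → i ∈ range n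
∈-range n s lt refl = subst (_∈ range n) (ℤ.m-n≡m⊖n s (suc n)) (∈-map⁺ _ (∈-upTo⁺ lt))

-- `range` starts at -(n+1), so the index of z is z + n + 1: this gives t + n + 1 for column t, n -
-- t for column -1-t, and q + 1 for height q - n.
site∈range² : ∀ n b t q → Inside n t q → depth b t ∈ range n × q ⊖ n ∈ range n
site∈range² n b t q (t≤q , lt) = depth∈ b , ∈-range n (suc q) (s≤s (m≤n⇒m≤1+n (m+n≤o⇒m≤o (suc q) lt))) (ℤ.[1+m]⊖[1+n]≡m⊖n q n)
  where
  t<n : t < n
  t<n = ≰⇒> (λ n≤t → outside n≤t (t≤q , lt))
  depth∈ : ∀ b → depth b t ∈ range n
  depth∈ true = ∈-range n (t + suc n) (subst (t + suc n <_) (sym (dbl-n (suc n))) (+-monoˡ-< (suc n) (m≤n⇒m≤1+n t<n)))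
    (trans (ℤ.⊖-≥ (m≤n+m (suc n) t)) (cong ℤ.+_ (m+n∸n≡m t (suc n))))
  depth∈ false = ∈-range n (n ∸ t)
    (≤-<-trans (m∸n≤m n t) (subst (n <_) (sym (dbl-n (suc n))) (m≤m+n (suc n) (suc n))))
    (trans (ℤ.⊖-≤ (≤-trans (m∸n≤m n t) (n≤1+n n)))
      (cong (λ d → ℤ.- ℤ.+ d) (trans (cong (_∸ (n ∸ t)) (sym (cong suc (m∸n+n≡m (<⇒≤ t<n)))))
        (trans (cong (_∸ (n ∸ t)) (sym (+-suc (n ∸ t) t))) (m+n∸m≡n (n ∸ t) (suc t))))))

grid : ℕ → List Cell
grid n = concatMap (λ i → map (λ j → (i , j)) (range n)) (range n)

grid-unique : ∀ n → Unique (grid n)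
grid-unique n = subst Unique (sym (concatMap-map (range n) (range n)))
  (Unique.cartesianProduct⁺ (range-unique n) (range-unique n))

cells-unique : ∀ n → Unique (cells n)
cells-unique n = Unique.filter⁺ (λ c → inAD n c ≟B true) (grid-unique n)

cells-sound : ∀ n {c} → c ∈ cells n → inAD n c ≡ true
cells-sound n m = proj₂ (∈-filter⁻ (λ c → inAD n c ≟B true) {xs = grid n} m)

cells-complete : ∀ n c → inAD n c ≡ true → c ∈ cells n
cells-complete n c e = ∈-filter⁺ (λ c → inAD n c ≟B true)
  (subst (c ∈_) (sym (concatMap-map (range n) (range n))) (in-grid (asSite n c e))) e
  where
  in-grid : ∀ {c} → IsSite n c → c ∈ cartesianProduct (range n) (range n)
  in-grid (isSite b t q i) = ∈-cartesianProduct⁺ (proj₁ (site∈range² n b t q i)) (proj₂ (site∈range² n b t q i))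

module Diamond (n : ℕ) where
  open Sites (siteOf n) (siteOf-injective n) public

  -- Two lists without repetition that have the same members are permutations of each other.
  cells-↭ : cells n ↭ diamondCells n
  cells-↭ = ∼bag⇒↭ (unique∧set⇒bag (cells-unique n) (diamondCells-unique n) (mk⇔ to from))
    where
    e = +-identityʳ n
    to : ∀ {c} → c ∈ cells n → c ∈ diamondCells n
    to {c} m with asSite n c (cells-sound n m)
    ... | isSite true t q i = ∈-++⁺ˡ (halfCells-∈ n 0 e z≤n i)
    ... | isSite false t q i = ∈-++⁺ʳ (halfCells true n 0 0) (halfCells-∈ n 0 e z≤n i)
    from : ∀ {c} → c ∈ diamondCells n → c ∈ cells n
    from = All.lookup {P = _∈ cells n} (All.++⁺
      (halfCells-All n 0 e (λ t q _ i → cells-complete n (siteOf n true t q) (inside⇒inAD n true t q i)))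
      (halfCells-All n 0 e (λ t q _ i → cells-complete n (siteOf n false t q) (inside⇒inAD n false t q i))))

  east north : Cell → Cell
  east (i , j) = i ℤ.+ ℤ.+ 1 , j
  north (i , j) = i , j ℤ.+ ℤ.+ 1

  links : (Cell → Cell) → List Domino
  links f = map (λ c → c , f c) (filter (λ c → inAD n (f c) ≟B true) (cells n))

  dominoes-links : dominoes n ≡ links east ++ links north
  dominoes-links = cong₂ _++_
    (concatMap-if (inAD n ∘ east) (λ c → c , east c) (λ { (i , j) → refl }) (cells n))
    (concatMap-if (inAD n ∘ north) (λ c → c , north c) (λ { (i , j) → refl }) (cells n))

  links-unique : ∀ f → Unique (links f)
  links-unique f = Unique.map⁺ (cong proj₁) (Unique.filter⁺ (λ c → inAD n (f c) ≟B true) (cells-unique n))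

  links-sound : ∀ f {d} → d ∈ links f → ∃[ c ] inAD n c ≡ true × inAD n (f c) ≡ true × d ≡ (c , f c)
  links-sound f m with ∈-map⁻ _ m
  ... | c , m′ , e with ∈-filter⁻ (λ c → inAD n (f c) ≟B true) {xs = cells n} m′
  ...   | m″ , e′ = c , cells-sound n m″ , e′ , e

  links-complete : ∀ f c {c′} → c′ ≡ f c → inAD n c ≡ true → inAD n c′ ≡ true → (c , c′) ∈ links f
  links-complete f c refl e e′ = ∈-map⁺ _ (∈-filter⁺ (λ c → inAD n (f c) ≟B true) (cells-complete n c e) e′)

  dominoes-unique : Unique (dominoes n)
  dominoes-unique = subst Unique (sym dominoes-links)
    (Unique.++⁺ (links-unique east) (links-unique north) disjoint)
    where
    disjoint : ∀ {d} → ¬ (d ∈ links east × d ∈ links north)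
    disjoint (m , m′) with links-sound east m | links-sound north m′
    -- The cells of a northern link share their first coordinate; those of an eastern link differ
    -- there by 1.
    ... | (i , j) , _ , _ , refl | c′ , _ , _ , e =
      ℤ.i≢suc[i] {i} (trans (trans (cong (proj₁ ∘ proj₁) e) (sym (cong (proj₁ ∘ proj₂) e))) (ℤ.+-comm i (ℤ.+ 1)))

  dominoes-↭ : dominoes n ↭ diamondDominoes n
  dominoes-↭ = ∼bag⇒↭ (unique∧set⇒bag dominoes-unique (diamondDominoes-unique n) (mk⇔ to from))
    where
    e = +-identityʳ n
    cut = cutDominoes 0 (dbl n)
    inHalf : ∀ b {d} → d ∈ halfDominoes b n 0 0 → d ∈ diamondDominoes n
    inHalf true m = ∈-++⁺ʳ cut (∈-++⁺ˡ m)
    inHalf false m = ∈-++⁺ʳ cut (∈-++⁺ʳ (halfDominoes true n 0 0) m)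
    to-east : ∀ {c} → IsSite n c → inAD n (east c) ≡ true → (c , east c) ∈ diamondDominoes n
    to-east (isSite true t q i) e′ = subst (λ c → (siteOf n true t q , c) ∈ diamondDominoes n)
      (cong (_, q ⊖ n) (sym (depth-true-suc t)))
      (inHalf true (outward-∈ n 0 e z≤n i (inAD⇒inside n true (suc t) q
        (subst (λ d → inAD n (d , q ⊖ n) ≡ true) (depth-true-suc t) e′))))
    -- From column -1 the eastern neighbour lies beyond the cut; from columns further left it lies
    -- closer to the cut, so the link is the neighbour's `outward` domino.
    to-east (isSite false zero q (_ , lt)) e′ =
      ∈-++⁺ˡ (across-∈ 0 (dbl n) z≤n (subst (_< dbl n) (+-identityʳ q) lt))
    to-east (isSite false (suc t) q i) e′ =
      inHalf false (outward-∈ n 0 e z≤n (inAD⇒inside n false t q e′) i)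
    to-north : ∀ {c} → IsSite n c → inAD n (north c) ≡ true → (c , north c) ∈ diamondDominoes n
    to-north (isSite b t q i) e′ = subst (λ j → (siteOf n b t q , (depth b t , j)) ∈ diamondDominoes n)
      (sym (⊖-suc q n))
      (inHalf b (along-∈ n 0 e z≤n i (inAD⇒inside n b t (suc q)
        (subst (λ j → inAD n (depth b t , j) ≡ true) (⊖-suc q n) e′))))
    to : ∀ {d} → d ∈ dominoes n → d ∈ diamondDominoes n
    to {d} m with ∈-++⁻ (links east) (subst (d ∈_) dominoes-links m)
    ... | inj₁ m′ with links-sound east m′
    ...   | c , a , b , refl = to-east (asSite n c a) b
    to {d} m | inj₂ m′ with links-sound north m′
    ...   | c , a , b , refl = to-north (asSite n c a) b
    isEast : ∀ {c c′} → c′ ≡ east c → inAD n c ≡ true → inAD n c′ ≡ true → (c , c′) ∈ dominoes n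
    isEast {c} {c′} p a b = subst ((c , c′) ∈_) (sym dominoes-links) (∈-++⁺ˡ (links-complete east c p a b))
    isNorth : ∀ {c c′} → c′ ≡ north c → inAD n c ≡ true → inAD n c′ ≡ true → (c , c′) ∈ dominoes n
    isNorth {c} {c′} p a b = subst ((c , c′) ∈_) (sym dominoes-links)
      (∈-++⁺ʳ (links east) (links-complete north c p a b))
    from-half : ∀ b → All (_∈ dominoes n) (halfDominoes b n 0 0)
    from-half true = halfDominoes-All n 0 e
      (λ t q i i′ → isNorth (cong (ℤ.+ t ,_) (sym (⊖-suc q n))) (inside⇒inAD n true t q i) (inside⇒inAD n true t (suc q) i′))
      (λ t q i i′ → isEast (cong (_, q ⊖ n) (sym (depth-true-suc t))) (inside⇒inAD n true t q i) (inside⇒inAD n true (suc t) q i′))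
    from-half false = halfDominoes-All n 0 e
      (λ t q i i′ → isNorth (cong (-[1+ t ] ,_) (sym (⊖-suc q n))) (inside⇒inAD n false t q i) (inside⇒inAD n false t (suc q) i′))
      (λ t q i i′ → isEast refl (inside⇒inAD n false (suc t) q i′) (inside⇒inAD n false t q i))
    from : ∀ {d} → d ∈ diamondDominoes n → d ∈ dominoes n
    from = All.lookup {P = _∈ dominoes n} (All.++⁺
      (cutDominoes-All 0 (dbl n) (λ q _ lt →
        let i = z≤n , subst (_< dbl n) (sym (+-identityʳ q)) lt
        in isEast refl (inside⇒inAD n false 0 q i) (inside⇒inAD n true 0 q i)))
      (All.++⁺ (from-half true) (from-half false)))

-- The number of tilings and the closed form.

numTilings-half : ∀ n → numTilings n ≡ total (half n ⊙ half n)
numTilings-half n = begin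
  numTilings n
    ≡⟨ numTilings-tilings n ⟩
  tilings (cells n) (dominoes n) (λ _ → 0)
    ≡⟨ tilings-↭ˡ (dominoes n) (λ _ → 0) cells-↭ ⟩
  tilings (diamondCells n) (dominoes n) (λ _ → 0)
    ≡⟨ tilings-↭ʳ (diamondCells n) (λ _ → 0) dominoes-↭ ⟩
  tilings (diamondCells n) (diamondDominoes n) (λ _ → 0)
    ≡⟨ diamond-tilings n ⟩
  total (half n ⊙ half n) ∎
  where
  open ≡-Reasoning
  open Diamond n

-- The increment is the multiple (n+1) * 2 of 2, so the rounding division splits exactly.
triangular : ∀ n → (suc n * (suc n + 1)) / 2 ≡ suc n + (n * (n + 1)) / 2
triangular n = begin
  (suc n * (suc n + 1)) / 2            ≡⟨ cong (_/ 2) (expand n) ⟩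
  (n * (n + 1) + suc n * 2) / 2        ≡⟨ +-distrib-/-∣ʳ (n * (n + 1)) (n∣m*n (suc n)) ⟩
  (n * (n + 1)) / 2 + (suc n * 2) / 2  ≡⟨ cong ((n * (n + 1)) / 2 +_) (m*n/n≡m (suc n) 2) ⟩
  (n * (n + 1)) / 2 + suc n            ≡⟨ +-comm _ (suc n) ⟩
  suc n + (n * (n + 1)) / 2            ∎
  where
  open ≡-Reasoning
  expand : ∀ n → suc n * (suc n + 1) ≡ n * (n + 1) + suc n * 2
  expand = solve-∀

norm-power : ∀ n → total (half n ⊙ half n) ≡ 2 ^ ((n * (n + 1)) / 2)
norm-power zero = refl
norm-power (suc n) = begin
  total (half (suc n) ⊙ half (suc n))     ≡⟨ norm-step n ⟩
  2 ^ suc n * total (half n ⊙ half n)     ≡⟨ cong (2 ^ suc n *_) (norm-power n) ⟩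
  2 ^ suc n * 2 ^ ((n * (n + 1)) / 2)     ≡⟨ sym (^-distribˡ-+-* 2 (suc n) _) ⟩
  2 ^ (suc n + (n * (n + 1)) / 2)         ≡⟨ cong (2 ^_) (sym (triangular n)) ⟩
  2 ^ ((suc n * (suc n + 1)) / 2)         ∎
  where open ≡-Reasoning

theorem3 : (n : ℕ) → 1 ≤ n →
    (normC n ≡ numTilings n) × (normC n ≡ 2 ^ ((n * (n + 1)) / 2))
theorem3 (suc n) _ =
  trans (normC-half n) (sym (numTilings-half (suc n))) , trans (normC-half n) (norm-power (suc n))
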